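{- Let $F$ be a forest with no vertices of degree $2$ and no isolated vertices, and let $n_1$ denote the number of vertices of degree one in $F$. Then \[ tvs(F)=\left\lceil \tfrac{n_1+1}{2} \right\rceil. \]
   Context: All graphs are finite, simple and undirected. A total weighting of a graph $G$ with labels in $\{1,\dots,s\}$ is a map $w: V(G)\cup E(G)\to\{1,2,\dots,s\}$. The weighted degree of a vertex $v$ is $wt_G(v)=w(v)+\sum_{e\in E(G),\, v\in e} w(e)$. The weighting is irregular if $wt_G(u)\neq wt_G(v)$ for every pair of distinct vertices $u,v$. The total vertex irregularity strength $tvs(G)$ is the smallest integer $s$ such that $G$ admits an irregular total weighting with labels in $\{1,2,\dots,s\}$. -}

module Defs where

open import Data.Nat using (ℕ; zero; suc; _+_; _≤_; _≟_)
open import Data.Bool using (Bool; true; false; if_then_else_)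
open import Data.Fin using (Fin; zero; suc; inject₁; fromℕ)
open import Data.List using (List; length; filter; map; allFin)
open import Data.Nat.ListAction using (sum)
open import Data.Product using (Σ; _×_; ∃)
open import Function.Definitions using (Injective)
open import Relation.Binary.PropositionalEquality using (_≡_; _≢_)
open import Relation.Nullary using (¬_)

record Graph (n : ℕ) : Set where
  field
    adj   : Fin n → Fin n → Bool
    sym   : ∀ u v → adj u v ≡ adj v u
    irrefl : ∀ v → adj v v ≡ false
open Graph public

deg : ∀ {n} → Graph n → Fin n → ℕ
deg G v = sum (map (λ u → if adj G v u then 1 else 0) (allFin _))

n₁ : ∀ {n} → Graph n → ℕ
n₁ {n} G = length (filter (λ v → deg G v ≟ 1) (allFin n))

record Cycle {n : ℕ} (G : Graph n) : Set where
  field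
    k     : ℕ
    c     : Fin (3 + k) → Fin n
    inj   : Injective _≡_ _≡_ c
    step  : ∀ (i : Fin (2 + k)) → adj G (c (inject₁ i)) (c (suc i)) ≡ true
    close : adj G (c (fromℕ (2 + k))) (c zero) ≡ true

Forest : ∀ {n} → Graph n → Set
Forest G = ¬ Cycle G

record TotalWeighting {n : ℕ} (G : Graph n) (s : ℕ) : Set where
  field
    wv      : Fin n → ℕ
    we      : Fin n → Fin n → ℕ
    we-sym  : ∀ u v → adj G u v ≡ true → we u v ≡ we v u
    wv-low  : ∀ v → 1 ≤ wv v
    wv-high : ∀ v → wv v ≤ s
    we-low  : ∀ u v → adj G u v ≡ true → 1 ≤ we u v
    we-high : ∀ u v → adj G u v ≡ true → we u v ≤ s
open TotalWeighting public

wt : ∀ {n} {G : Graph n} {s} → TotalWeighting G s → Fin n → ℕ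
wt {G = G} w v = wv w v + sum (map (λ u → if adj G v u then we w v u else 0) (allFin _))

Irregular : ∀ {n} {G : Graph n} {s} → TotalWeighting G s → Set
Irregular {n} w = ∀ (u v : Fin n) → u ≢ v → wt w u ≢ wt w v

HasIrregular : ∀ {n} → Graph n → ℕ → Set
HasIrregular G s = Σ (TotalWeighting G s) Irregular

IsTvs : ∀ {n} → Graph n → ℕ → Set
IsTvs G t = HasIrregular G t × (∀ s → HasIrregular G s → t ≤ s)

{-# OPTIONS --safe #-}

-- Lower bound: the leaves have distinct weights in [2, 2s].
--
-- Upper bound: rank the leaves and give them the weights t = 2, …, n₁ + 1 ≤ 2s.  A leaf is
-- small if t ≤ s.  Pendant edges at small leaves are labelled 1 and all other edges s, so an
-- internal vertex with b edges labelled s is `high' if b ≥ 3 and `low' if b ≤ 2.  A low vertex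
-- has a small leaf a with t(a) larger than the number of its small leaves, and its own label
-- can be chosen to make its weight 2s + t(a), which lies in (2s, 3s] and determines it; if
-- b = 1, the edge at a has to be relabelled t(a) − 1 for this.  A high vertex has weight above
-- 3s, and its own label can realise any residue modulo s, so up to s high vertices can be
-- separated.  It remains to rank the leaves such that b ≥ 1 everywhere and at most s vertices
-- are high; here acyclicity enters, through Σ_{u ∈ U} deg_U(u) ≤ 2|U|.
--
-- The ranking puts first the leaves that can all be made small while leaving b ≥ 2 everywhere.
-- If the small leaves do not exhaust these, Σ (deg − 2) ≤ 0 shows that the numbers of high
-- vertices and of small leaves add up to at most n₁.  Otherwise every high vertex has at least
-- three internal neighbours, and there are at most as many such vertices as internal vertices
-- with one internal neighbour, each of which has two leaves.

module Submission where

open import Defs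
open import Data.Bool using (Bool; true; false; not; _∧_; _∨_; if_then_else_)
import Data.Bool
open import Data.Fin using (Fin)
open import Data.Fin as Fin using (zero; suc; toℕ; fromℕ; inject₁)
import Data.Fin.Properties as Fin
open import Data.List using (length; filter; map; allFin; tabulate)
open import Data.List.Properties using (map-tabulate)
import Data.Nat.ListAction as List
open import Data.Nat
open import Data.Nat.DivMod
open import Data.Nat.Induction using (<-rec)
open import Data.Nat.Properties
open import Data.Nat.Solver using (module +-*-Solver)
open import Data.Product using (Σ; ∃; _×_; _,_; proj₁; proj₂)
open import Data.Sum using (_⊎_; inj₁; inj₂)
open import Data.Empty using (⊥-elim)
open import Function using (_∘_; id)
open import Function.Definitions using (Injective)
open import Relation.Binary using (tri<; tri≈; tri>)
open import Relation.Binary.PropositionalEquality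
  using (_≡_; _≢_; refl; trans; cong; cong₂; subst; subst₂; module ≡-Reasoning) renaming (sym to ≡-sym)
open import Relation.Nullary using (¬_; Dec; yes; no; does; contradiction; _×-dec_)
open import Relation.Nullary.Decidable using (dec-true; dec-false; decidable-stable)
import Algebra.Properties.Semiring.Sum +-*-semiring as ∑

-- Counting

[_] : Bool → ℕ
[ b ] = if b then 1 else 0

witness : ∀ {a} {A : Set a} (a? : Dec A) → does a? ≡ true → A
witness (yes a) _ = a

refutation : ∀ {a} {A : Set a} (a? : Dec A) → does a? ≡ false → ¬ A
refutation (no ¬a) _ = ¬a

∧-intro : ∀ {a b} → a ≡ true → b ≡ true → a ∧ b ≡ true
∧-intro refl refl = refl

∧-elimˡ : ∀ {a b} → a ∧ b ≡ true → a ≡ true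
∧-elimˡ {true} _ = refl

∧-elimʳ : ∀ {a b} → a ∧ b ≡ true → b ≡ true
∧-elimʳ {true} p = p

not-intro : ∀ {b} → ¬ (b ≡ true) → not b ≡ true
not-intro {true}  ¬p = contradiction refl ¬p
not-intro {false} _  = refl

not-elim : ∀ {b} → not b ≡ true → ¬ (b ≡ true)
not-elim {false} _ ()

true? : ∀ b → b ≡ true ⊎ b ≡ false
true? true  = inj₁ refl
true? false = inj₂ refl

false≢true : ∀ {b} → b ≡ false → ¬ (b ≡ true)
false≢true refl ()

-- Keeping sums opaque lets unification recover their arguments.
opaque
  sum : ∀ {n} → (Fin n → ℕ) → ℕ
  sum = ∑.sum

  cnt : ∀ {n} → (Fin n → Bool) → ℕ
  cnt P = sum (λ i → [ P i ])

  cnt≡sum : ∀ {n} (P : Fin n → Bool) → cnt P ≡ sum (λ i → [ P i ])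
  cnt≡sum P = refl

  sum-cong : ∀ {n} {f g : Fin n → ℕ} → (∀ i → f i ≡ g i) → sum f ≡ sum g
  sum-cong = ∑.sum-cong-≗

  sum-*ˡ : ∀ {n} c (f : Fin n → ℕ) → sum (λ i → c * f i) ≡ c * sum f
  sum-*ˡ c f = ≡-sym (∑.*-distribˡ-sum c f)

  sum-mono : ∀ {n} {f g : Fin n → ℕ} → (∀ i → f i ≤ g i) → sum f ≤ sum g
  sum-mono {zero}  h = z≤n
  sum-mono {suc n} h = +-mono-≤ (h zero) (sum-mono (h ∘ suc))

  sum-zero : ∀ {n} {f : Fin n → ℕ} → (∀ i → f i ≡ 0) → sum f ≡ 0
  sum-zero {n} h = trans (∑.sum-cong-≗ h) (∑.sum-replicate-zero n)

  sum-+ : ∀ {n} (f g : Fin n → ℕ) → sum (λ i → f i + g i) ≡ sum f + sum g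
  sum-+ = ∑.∑-distrib-+

  sum-swap : ∀ {m n} (f : Fin m → Fin n → ℕ) →
             sum (λ i → sum (λ j → f i j)) ≡ sum (λ j → sum (λ i → f i j))
  sum-swap = ∑.∑-comm

  sum-cnt-swap : ∀ {m n} (R : Fin m → Fin n → Bool) →
                 sum (λ i → cnt (λ j → R i j)) ≡ sum (λ j → cnt (λ i → R i j))
  sum-cnt-swap R = sum-swap (λ i j → [ R i j ])

  term≤sum : ∀ {n} (f : Fin n → ℕ) i → f i ≤ sum f
  term≤sum f zero    = m≤m+n _ _
  term≤sum f (suc i) = ≤-trans (term≤sum (f ∘ suc) i) (m≤n+m _ _)

  sum-single : ∀ {n} (f : Fin n → ℕ) a → (∀ i → i ≢ a → f i ≡ 0) → sum f ≡ f a
  sum-single {suc n} f zero h = trans (cong (f zero +_) (sum-zero (λ i → h (suc i) λ ()))) (+-identityʳ _)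
  sum-single {suc n} f (suc a) h =
    cong₂ _+_ (h zero λ ()) (sum-single (f ∘ suc) a (λ i i≢a → h (suc i) (i≢a ∘ Fin.suc-injective)))

  sum-allFin : ∀ {n} (f : Fin n → ℕ) → List.sum (map f (allFin n)) ≡ sum f
  sum-allFin f = trans (cong List.sum (map-tabulate id f)) (go f)
    where
    go : ∀ {n} (f : Fin n → ℕ) → List.sum (tabulate f) ≡ sum f
    go {zero}  f = refl
    go {suc n} f = cong (f zero +_) (go (f ∘ suc))

  length-filter-allFin : ∀ {n} {P : Fin n → Set} (P? : ∀ i → Dec (P i)) →
                         length (filter P? (allFin n)) ≡ cnt (does ∘ P?)
  length-filter-allFin {P = P} P? = go id
    where
    go : ∀ {m} (g : Fin m → Fin _) → length (filter P? (tabulate g)) ≡ cnt (does ∘ P? ∘ g)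
    go {zero}  g = refl
    go {suc m} g with does (P? (g zero))
    ... | true  = cong suc (go (g ∘ suc))
    ... | false = go (g ∘ suc)

  []-mono : ∀ {a b} → (a ≡ true → b ≡ true) → [ a ] ≤ [ b ]
  []-mono {false} h = z≤n
  []-mono {true}  h rewrite h refl = ≤-refl

  cnt-mono : ∀ {n} {P Q : Fin n → Bool} → (∀ i → P i ≡ true → Q i ≡ true) → cnt P ≤ cnt Q
  cnt-mono h = sum-mono (λ i → []-mono (h i))

  cnt-cong : ∀ {n} {P Q : Fin n → Bool} → (∀ i → P i ≡ Q i) → cnt P ≡ cnt Q
  cnt-cong h = sum-cong (λ i → cong [_] (h i))

  cnt-split : ∀ {n} (P Q : Fin n → Bool) →
              cnt P ≡ cnt (λ i → P i ∧ Q i) + cnt (λ i → P i ∧ not (Q i))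
  cnt-split P Q = trans (sum-cong (λ i → go (P i) (Q i))) (sum-+ (λ i → [ P i ∧ Q i ]) _)
    where
    go : ∀ a b → [ a ] ≡ [ a ∧ b ] + [ a ∧ not b ]
    go false _     = refl
    go true  true  = refl
    go true  false = refl

  cnt-true : ∀ n → cnt {n} (λ _ → true) ≡ n
  cnt-true zero    = refl
  cnt-true (suc n) = cong suc (cnt-true n)

  cnt-pos : ∀ {n} (P : Fin n → Bool) {i} → P i ≡ true → 1 ≤ cnt P
  cnt-pos P {i} p = subst (λ b → [ b ] ≤ cnt P) p (term≤sum ([_] ∘ P) i)

  cnt-zero : ∀ {n} (P : Fin n → Bool) → (∀ i → ¬ (P i ≡ true)) → cnt P ≡ 0
  cnt-zero P h = sum-zero λ i → go (P i) (h i)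
    where
    go : ∀ b → ¬ (b ≡ true) → [ b ] ≡ 0
    go false _ = refl
    go true  h = contradiction refl h

  cnt-∃ : ∀ {n} (P : Fin n → Bool) → 1 ≤ cnt P → ∃ λ i → P i ≡ true
  cnt-∃ P h with Fin.any? (λ i → P i Data.Bool.≟ true)
  ... | yes p = p
  ... | no ¬p = contradiction (subst (1 ≤_) (cnt-zero P λ i p → ¬p (i , p)) h) λ ()

  cnt-unique : ∀ {n} (P : Fin n → Bool) →
               (∀ i j → P i ≡ true → P j ≡ true → i ≡ j) → cnt P ≤ 1
  cnt-unique P h with Fin.any? (λ i → P i Data.Bool.≟ true)
  ... | no ¬p = ≤-trans (≤-reflexive (cnt-zero P λ i p → ¬p (i , p))) z≤n
  ... | yes (a , Pa) = ≤-trans (≤-reflexive (sum-single _ a other)) ([]≤1 (P a))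
    where
    []≤1 : ∀ b → [ b ] ≤ 1
    []≤1 false = z≤n
    []≤1 true  = ≤-refl
    other : ∀ i → i ≢ a → [ P i ] ≡ 0
    other i i≢a with P i in eq
    ... | false = refl
    ... | true  = contradiction (h i a eq Pa) i≢a

  cnt-≟ : ∀ {n} (a : Fin n) → cnt (λ i → does (i Fin.≟ a)) ≡ 1
  cnt-≟ a = trans (sum-single _ a λ i i≢a → cong [_] (dec-false (i Fin.≟ a) i≢a))
                  (cong [_] (dec-true (a Fin.≟ a) refl))

-- Double counting of the pairs `(i , f i)`: each row with `P i` contains one, each column at most
-- one, and a column without `Q` none.
cnt-inject : ∀ {m n} (P : Fin m → Bool) (Q : Fin n → Bool) (f : Fin m → Fin n) →
             (∀ i → P i ≡ true → Q (f i) ≡ true) →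
             (∀ i j → P i ≡ true → P j ≡ true → f i ≡ f j → i ≡ j) → cnt P ≤ cnt Q
cnt-inject P Q f f-Q f-inj = begin
  cnt P                                 ≡⟨ cnt≡sum P ⟩
  sum (λ i → [ P i ])                   ≤⟨ sum-mono row ⟩
  sum (λ i → cnt (λ k → hit i k))       ≡⟨ sum-cnt-swap hit ⟩
  sum (λ k → cnt (λ i → hit i k))       ≤⟨ sum-mono col ⟩
  sum (λ k → [ Q k ])                   ≡⟨ cnt≡sum Q ⟨
  cnt Q                                 ∎
  where
  open ≤-Reasoning
  hit : _ → _ → Bool
  hit i k = P i ∧ does (f i Fin.≟ k)
  row : ∀ i → [ P i ] ≤ cnt (hit i)
  row i with P i
  ... | false = z≤n
  ... | true  = cnt-pos (λ k → does (f i Fin.≟ k)) (dec-true (f i Fin.≟ f i) refl)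
  col : ∀ k → cnt (λ i → hit i k) ≤ [ Q k ]
  col k with Q k in eq
  ... | true  = cnt-unique (λ i → hit i k) λ i j p q →
                  f-inj i j (∧-elimˡ p) (∧-elimˡ q)
                    (trans (witness (f i Fin.≟ k) (∧-elimʳ p)) (≡-sym (witness (f j Fin.≟ k) (∧-elimʳ q))))
  ... | false = ≤-reflexive (cnt-zero (λ i → hit i k) λ i p →
                  false≢true eq (subst (λ x → Q x ≡ true) (witness (f i Fin.≟ k) (∧-elimʳ p)) (f-Q i (∧-elimˡ p))))

-- Induction on the length `h`: at most one element takes the top value `lo + h`, and the others fit
-- into the shorter interval.
cnt-interval : ∀ {n} (P : Fin n → Bool) (t : Fin n → ℕ) lo h →
               (∀ i → P i ≡ true → lo ≤ t i × t i < lo + h) →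
               (∀ i j → P i ≡ true → P j ≡ true → t i ≡ t j → i ≡ j) → cnt P ≤ h
cnt-interval {n} P t lo zero bounds inj =
  ≤-reflexive (cnt-zero P λ i p → <⇒≱ (proj₂ (bounds i p)) (subst (_≤ t i) (≡-sym (+-identityʳ lo)) (proj₁ (bounds i p))))
cnt-interval {n} P t lo (suc h) bounds inj = begin
  cnt P                 ≡⟨ cnt-split P low ⟩
  cnt (λ i → P i ∧ low i) + cnt (λ i → P i ∧ not (low i))
    ≤⟨ +-mono-≤ (cnt-interval _ t lo h
                   (λ i p → proj₁ (bounds i (∧-elimˡ p)) , witness (t i <? lo + h) (∧-elimʳ p))
                   (λ i j p q → inj i j (∧-elimˡ p) (∧-elimˡ q)))
                (cnt-unique _ λ i j p q → inj i j (∧-elimˡ p) (∧-elimˡ q) (trans (top i p) (≡-sym (top j q)))) ⟩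
  h + 1                 ≡⟨ +-comm h 1 ⟩
  suc h                 ∎
  where
  open ≤-Reasoning
  low : Fin n → Bool
  low i = does (t i <? lo + h)
  top : ∀ i → P i ∧ not (low i) ≡ true → t i ≡ lo + h
  top i p = ≤-antisym (≤-pred (subst (t i <_) (+-suc lo h) (proj₂ (bounds i (∧-elimˡ p)))))
                      (≮⇒≥ λ lt → not-elim (∧-elimʳ p) (dec-true (t i <? lo + h) lt))

argmax : ∀ {n} (P : Fin n → Bool) (f : Fin n → ℕ) → (∃ λ i → P i ≡ true) →
         ∃ λ a → P a ≡ true × (∀ i → P i ≡ true → f i ≤ f a)
argmax {zero} P f (() , _)
argmax {suc n} P f ex with Fin.any? (λ i → P (suc i) Data.Bool.≟ true) | P zero in P0
argmax {suc n} P f (zero , p)  | no ¬t | false = contradiction p (false≢true P0)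
argmax {suc n} P f (suc i , p) | no ¬t | _     = contradiction (i , p) ¬t
argmax {suc n} P f (zero , p)  | no ¬t | true  =
  zero , p , λ { zero _ → ≤-refl ; (suc i) q → contradiction (i , q) ¬t }
argmax {suc n} P f ex | yes t | b with argmax (P ∘ suc) (f ∘ suc) t
argmax {suc n} P f ex | yes t | false | a , Pa , max =
  suc a , Pa , λ { zero q → contradiction q (false≢true P0) ; (suc i) q → max i q }
argmax {suc n} P f ex | yes t | true | a , Pa , max with ≤-total (f zero) (f (suc a))
... | inj₁ le = suc a , Pa , λ { zero q → le ; (suc i) q → max i q }
... | inj₂ ge = zero , P0 , λ { zero q → ≤-refl ; (suc i) q → ≤-trans (max i q) ge }

cnt-remove : ∀ {n} (U : Fin n → Bool) u → U u ≡ true → cnt U ≡ suc (cnt (λ v → U v ∧ not (does (v Fin.≟ u))))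
cnt-remove U u Uu = trans (cnt-split U (λ v → does (v Fin.≟ u)))
  (cong (_+ cnt (λ v → U v ∧ not (does (v Fin.≟ u)))) (trans (cnt-cong hit) (cnt-≟ u)))
  where
  hit : ∀ v → U v ∧ does (v Fin.≟ u) ≡ does (v Fin.≟ u)
  hit v with v Fin.≟ u
  ... | yes refl = ∧-intro Uu refl
  ... | no _     with U v
  ...   | true  = refl
  ...   | false = refl

cnt≤1⇒≡ : ∀ {n} (P : Fin n → Bool) → cnt P ≤ 1 → ∀ {i j} → P i ≡ true → P j ≡ true → i ≡ j
cnt≤1⇒≡ P le {i} {j} Pi Pj with i Fin.≟ j
... | yes i≡j = i≡j
... | no i≢j  = contradiction (≤-trans (s≤s (cnt-pos _ (∧-intro Pj (cong not (dec-false (j Fin.≟ i) (i≢j ∘ ≡-sym))))))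
                                (≤-trans (≤-reflexive (≡-sym (cnt-remove P i Pi))) le))
                              λ { (s≤s ()) }

-- Ranks with respect to a key

rank : ∀ {n} → (Fin n → Bool) → (Fin n → ℕ) → Fin n → ℕ
rank P key v = cnt (λ u → P u ∧ does (key u <? key v))

module _ {n} (P : Fin n → Bool) (key : Fin n → ℕ) where

  -- Whatever precedes `u` also precedes `v`, and so does `u`, which its own rank omits.
  rank-mono-< : ∀ {u v} → P u ≡ true → key u < key v → rank P key u < rank P key v
  rank-mono-< {u} {v} Pu lt = ≤-trans
    (s≤s (cnt-mono λ w q → ∧-intro
      (∧-intro (∧-elimˡ q) (dec-true (key w <? key v) (<-trans (before q) lt)))
      (not-intro λ e → <-irrefl (cong key (witness (w Fin.≟ u) e)) (before q))))
    (≤-reflexive (≡-sym (cnt-remove (λ w → P w ∧ does (key w <? key v)) u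
                           (∧-intro Pu (dec-true (key u <? key v) lt)))))
    where
    before : ∀ {w} → P w ∧ does (key w <? key u) ≡ true → key w < key u
    before {w} q = witness (key w <? key u) (∧-elimʳ {P w} q)

  rank<cnt : ∀ {u} → P u ≡ true → rank P key u < cnt P
  rank<cnt {u} Pu = ≤-trans
    (s≤s (cnt-mono λ w q → ∧-intro (∧-elimˡ q)
      (not-intro λ e → <-irrefl (cong key (witness (w Fin.≟ u) e)) (witness (key w <? key u) (∧-elimʳ {P w} q)))))
    (≤-reflexive (≡-sym (cnt-remove P u Pu)))

  rank-reflects-≡ : ∀ {u v} → P u ≡ true → P v ≡ true → rank P key u ≡ rank P key v → key u ≡ key v
  rank-reflects-≡ {u} {v} Pu Pv eq with <-cmp (key u) (key v)
  ... | tri< lt _ _ = contradiction eq (<⇒≢ (rank-mono-< Pu lt))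
  ... | tri≈ _ e _  = e
  ... | tri> _ _ gt = contradiction (≡-sym eq) (<⇒≢ (rank-mono-< Pv gt))

-- Induced subgraphs of forests

adj-irrefl : ∀ {n} (G : Graph n) {u w} → adj G u w ≡ true → u ≢ w
adj-irrefl G {u} p refl = false≢true (irrefl G u) p

adj-sym : ∀ {n} (G : Graph n) {u w} → adj G u w ≡ true → adj G w u ≡ true
adj-sym G {u} {w} p = trans (Graph.sym G w u) p

degIn : ∀ {n} → Graph n → (Fin n → Bool) → Fin n → ℕ
degIn G U u = cnt (λ w → U w ∧ adj G u w)

module _ {n} (G : Graph n) where

  -- A shortest repetition along a walk without backtracking closes a cycle.
  closed-walk⇒Cycle : (x : ℕ → Fin n) → (∀ i → adj G (x i) (x (suc i)) ≡ true) →
                      (∀ i → x (2 + i) ≢ x i) → ∀ g i → x i ≡ x (i + suc g) → Cycle G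
  closed-walk⇒Cycle x step turn = <-rec _ go
    where
    Repeats : ℕ → ℕ → Set
    Repeats g i = ∃ λ (a : Fin (suc g)) → ∃ λ (b : Fin (suc g)) →
                    toℕ a < toℕ b × x (i + toℕ a) ≡ x (i + toℕ b)
    repeats? : ∀ g i → Dec (Repeats g i)
    repeats? g i = Fin.any? λ a → Fin.any? λ b →
                     (toℕ a <? toℕ b) ×-dec (x (i + toℕ a) Fin.≟ x (i + toℕ b))
    go : ∀ g → (∀ {h} → h < g → ∀ i → x i ≡ x (i + suc h) → Cycle G) →
         ∀ i → x i ≡ x (i + suc g) → Cycle G
    go zero rec i eq =
      contradiction (trans eq (cong x (+-comm i 1))) (adj-irrefl G (step i))
    go (suc zero) rec i eq =
      contradiction (≡-sym (trans eq (cong x (+-comm i 2)))) (turn i)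
    -- The offsets compared run from 0 to `2 + k`, so the return at offset `3 + k` is left out.
    go (suc (suc k)) rec i eq with repeats? (2 + k) i
    ... | yes (a , b , a<b , xa≡xb) = rec gap< (i + toℕ a) (trans xa≡xb (cong x shift))
      where
      gap : ℕ
      gap = toℕ b ∸ suc (toℕ a)
      gap< : gap < 2 + k
      gap< = ≤-trans (s≤s (∸-monoʳ-≤ (toℕ b) (s≤s z≤n)))
                     (≤-trans (≤-reflexive (suc-pred (toℕ b) {{>-nonZero (≤-trans (s≤s z≤n) a<b)}}))
                              (≤-pred (Fin.toℕ<n b)))
      shift : i + toℕ b ≡ i + toℕ a + suc gap
      shift = trans (cong (i +_) (trans (≡-sym (m+[n∸m]≡n a<b)) (≡-sym (+-suc (toℕ a) gap))))
                    (≡-sym (+-assoc i (toℕ a) (suc gap)))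
    ... | no ¬rep = record
      { k = k
      ; c = c
      ; inj = inj
      ; step = λ j → subst₂ (λ y z → adj G (x y) (x z) ≡ true)
                       (cong (i +_) (≡-sym (Fin.toℕ-inject₁ j))) (≡-sym (+-suc i (toℕ j)))
                       (step (i + toℕ j))
      ; close = subst₂ (λ y z → adj G (x y) z ≡ true)
                  (cong (i +_) (≡-sym (Fin.toℕ-fromℕ (2 + k))))
                  (trans (cong x (≡-sym (+-suc i (2 + k)))) (trans (≡-sym eq) (cong x (≡-sym (+-identityʳ i)))))
                  (step (i + (2 + k)))
      }
      where
      c : Fin (3 + k) → Fin n
      c a = x (i + toℕ a)
      inj : Injective _≡_ _≡_ c
      inj {a} {b} ca≡cb with Fin.<-cmp a b
      ... | tri< a<b _ _ = contradiction (a , b , a<b , ca≡cb) ¬rep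
      ... | tri≈ _ a≡b _ = a≡b
      ... | tri> _ _ b<a = contradiction (b , a , b<a , ≡-sym ca≡cb) ¬rep

  -- At most one of the two neighbours is `p`. If `p` is the vertex just left, this continues a walk
  -- without backtracking.
  other-neighbour : ∀ (U : Fin n → Bool) u p → 2 ≤ degIn G U u →
                    ∃ λ w → U w ∧ adj G u w ≡ true × w ≢ p
  other-neighbour U u p two with cnt-∃ (λ w → (U w ∧ adj G u w) ∧ not (does (w Fin.≟ p))) pos
    where
    open ≤-Reasoning
    pos : 1 ≤ cnt (λ w → (U w ∧ adj G u w) ∧ not (does (w Fin.≟ p)))
    pos = +-cancelˡ-≤ 1 _ _ (begin
      2               ≤⟨ two ⟩
      degIn G U u     ≡⟨ cnt-split (λ w → U w ∧ adj G u w) (λ w → does (w Fin.≟ p)) ⟩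
      _               ≤⟨ +-monoˡ-≤ _ (≤-trans (cnt-mono (λ w q → ∧-elimʳ q)) (≤-reflexive (cnt-≟ p))) ⟩
      1 + _           ∎)
  ... | w , q = w , ∧-elimˡ q , λ { refl → not-elim (∧-elimʳ q) (dec-true (w Fin.≟ w) refl) }

  -- A walk in `U` never has to turn back, and by pigeonhole its first `n + 1` vertices contain a
  -- repetition.
  minDegree2⇒Cycle : (U : Fin n → Bool) → (∃ λ u → U u ≡ true) →
                     (∀ u → U u ≡ true → 2 ≤ degIn G U u) → Cycle G
  minDegree2⇒Cycle U (u₀ , Uu₀) two = found (Fin.pigeonhole (n<1+n n) (λ i → x (toℕ i)))
    where
    State : Set
    State = Fin n × Σ (Fin n) λ u → U u ≡ true
    other : ((p , u , _) : State) → ∃ λ w → U w ∧ adj G u w ≡ true × w ≢ p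
    other (p , u , Uu) = other-neighbour U u p (two u Uu)
    next : State → State
    next st = proj₁ (proj₂ st) , proj₁ (other st) , ∧-elimˡ (proj₁ (proj₂ (other st)))
    walk : ℕ → State
    -- The start has no predecessor. Naming itself excludes nothing, as it is not its own neighbour.
    walk zero    = u₀ , u₀ , Uu₀
    walk (suc i) = next (walk i)
    x : ℕ → Fin n
    x i = proj₁ (proj₂ (walk i))
    found : (∃ λ i → ∃ λ j → i Fin.< j × x (toℕ i) ≡ x (toℕ j)) → Cycle G
    found (i , j , i<j , eq) =
      closed-walk⇒Cycle x (λ k → ∧-elimʳ {U (x (suc k))} (proj₁ (proj₂ (other (walk k)))))
        (λ k → proj₂ (proj₂ (other (walk (suc k)))))
        (toℕ j ∸ suc (toℕ i)) (toℕ i)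
        (trans eq (cong x (trans (≡-sym (m+[n∸m]≡n i<j)) (≡-sym (+-suc (toℕ i) _)))))

  -- Twice the number of edges of the subgraph induced by `U`.
  degSum : (Fin n → Bool) → ℕ
  degSum U = sum (λ u → cnt (λ w → U u ∧ U w ∧ adj G u w))

  -- An ordered adjacent pair in `U` avoids `u`, or starts at `u` (`row v w`), or ends at `u`
  -- (`row w v`).
  degSum-remove : ∀ U u → degSum U ≤ degSum (λ v → U v ∧ not (does (v Fin.≟ u))) + (degIn G U u + degIn G U u)
  degSum-remove U u = begin
    degSum U
      ≤⟨ sum-mono (λ v → cnt-mono-+ (split v)) ⟩
    sum (λ v → cnt (λ w → U′ v ∧ U′ w ∧ adj G v w) + (cnt (λ w → row v w) + cnt (λ w → row w v)))
      ≡⟨ trans (sum-+ _ _) (cong (degSum U′ +_) (sum-+ _ _)) ⟩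
    degSum U′ + (sum (λ v → cnt (λ w → row v w)) + sum (λ v → cnt (λ w → row w v)))
      ≡⟨ cong (λ z → degSum U′ + (z + sum (λ v → cnt (λ w → row w v)))) (sum-cnt-swap row) ⟩
    degSum U′ + (sum (λ w → cnt (λ v → row v w)) + sum (λ v → cnt (λ w → row w v)))
      ≤⟨ +-monoʳ-≤ (degSum U′) (+-mono-≤ col col) ⟩
    degSum U′ + (degIn G U u + degIn G U u) ∎
    where
    open ≤-Reasoning
    U′ : Fin n → Bool
    U′ v = U v ∧ not (does (v Fin.≟ u))
    row : Fin n → Fin n → Bool
    row v w = does (v Fin.≟ u) ∧ U w ∧ adj G u w
    cnt-mono-+ : {P Q R S : Fin n → Bool} → (∀ w → [ P w ] ≤ [ Q w ] + ([ R w ] + [ S w ])) →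
                 cnt P ≤ cnt Q + (cnt R + cnt S)
    cnt-mono-+ {P} {Q} {R} {S} h = begin
      cnt P                                         ≡⟨ cnt≡sum P ⟩
      _                                             ≤⟨ sum-mono h ⟩
      sum (λ w → [ Q w ] + ([ R w ] + [ S w ]))
        ≡⟨ trans (sum-+ ([_] ∘ Q) (λ w → [ R w ] + [ S w ])) (cong (sum ([_] ∘ Q) +_) (sum-+ ([_] ∘ R) ([_] ∘ S))) ⟩
      sum ([_] ∘ Q) + (sum ([_] ∘ R) + sum ([_] ∘ S))
        ≡⟨ cong₂ _+_ (cnt≡sum Q) (cong₂ _+_ (cnt≡sum R) (cnt≡sum S)) ⟨
      cnt Q + (cnt R + cnt S)                       ∎
    split : ∀ v w → [ U v ∧ U w ∧ adj G v w ] ≤ [ U′ v ∧ U′ w ∧ adj G v w ] + ([ row v w ] + [ row w v ])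
    split v w with v Fin.≟ u | w Fin.≟ u
    ... | yes refl | w≟u      = left (U v) (U w ∧ adj G v w) {[ (U v ∧ false) ∧ (U w ∧ not (does w≟u)) ∧ adj G v w ]}
      where
      left : ∀ a b {x y} → [ a ∧ b ] ≤ x + ([ b ] + y)
      left a b {x} = ≤-trans ([]-mono (∧-elimʳ {a} {b})) (≤-trans (m≤m+n _ _) (m≤n+m _ x))
    ... | no _     | yes refl rewrite Graph.sym G v w = right (U v) (U w) (adj G w v)
      where
      right : ∀ a b e {x} → [ a ∧ b ∧ e ] ≤ x + [ a ∧ e ]
      right true  true  e {x} = m≤n+m _ x
      right true  false e     = z≤n
      right false b     e     = z≤n
    ... | no _     | no _     = neither (U v) (U w) (adj G v w)
      where
      neither : ∀ a b e {x} → [ a ∧ b ∧ e ] ≤ [ (a ∧ true) ∧ (b ∧ true) ∧ e ] + x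
      neither true  true  e = m≤m+n _ _
      neither true  false e = z≤n
      neither false b     e = z≤n
    col : sum (λ w → cnt (λ v → row v w)) ≤ degIn G U u
    col = begin
      sum (λ w → cnt (λ v → row v w))     ≤⟨ sum-mono col-≤ ⟩
      sum (λ w → [ U w ∧ adj G u w ])     ≡⟨ cnt≡sum _ ⟨
      degIn G U u                         ∎
      where
      col-≤ : ∀ w → cnt (λ v → row v w) ≤ [ U w ∧ adj G u w ]
      col-≤ w with U w ∧ adj G u w
      ... | true  = ≤-trans (cnt-mono (λ v → ∧-elimˡ)) (≤-reflexive (cnt-≟ u))
      ... | false = ≤-reflexive (cnt-zero _ λ v p → false≢true refl (∧-elimʳ {does (v Fin.≟ u)} p))

  -- Induction on the size of `U`. By acyclicity a nonempty `U` has a vertex with at most one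
  -- neighbour in `U`; removing it lowers the left side by at most 2 and the right side by 2.
  forest-degSum : Forest G → ∀ U → degSum U ≤ 2 * cnt U
  forest-degSum acyclic U = go (cnt U) U refl
    where
    empty : ∀ (U : Fin n → Bool) → (∀ u → ¬ (U u ≡ true)) → degSum U ≤ 2 * cnt U
    empty U none = ≤-trans (≤-reflexive (sum-zero λ u → cnt-zero _ λ w p → none u (∧-elimˡ p))) z≤n
    go : ∀ c U → cnt U ≡ c → degSum U ≤ 2 * cnt U
    go c U eq with Fin.any? (λ u → (U u Data.Bool.≟ true) ×-dec (degIn G U u ≤? 1))
    go zero U eq | yes (u , Uu , _) = contradiction (trans (≡-sym (cnt-remove U u Uu)) eq) λ ()
    go (suc c) U eq | yes (u , Uu , le) = begin
      degSum U                                        ≤⟨ degSum-remove U u ⟩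
      degSum U′ + (degIn G U u + degIn G U u)         ≤⟨ +-mono-≤ (go c U′ (suc-injective (trans (≡-sym (cnt-remove U u Uu)) eq))) (+-mono-≤ le le) ⟩
      2 * cnt U′ + 2                                  ≡⟨ trans (+-comm _ 2) (≡-sym (*-suc 2 (cnt U′))) ⟩
      2 * suc (cnt U′)                                ≡⟨ cong (2 *_) (cnt-remove U u Uu) ⟨
      2 * cnt U                                       ∎
      where
      open ≤-Reasoning
      U′ : Fin n → Bool
      U′ v = U v ∧ not (does (v Fin.≟ u))
    go c U eq | no big with Fin.any? (λ u → U u Data.Bool.≟ true)
    ... | yes ex  = ⊥-elim (acyclic (minDegree2⇒Cycle U ex λ u Uu → ≰⇒> λ le → big (u , Uu , le)))
    ... | no none = empty U λ u Uu → none (u , Uu)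

-- The weighting defined by a ranking of the leaves

-- m + 1 + (r + m (s − 1)) mod s is the weight of the r-th high vertex, m being its edge sum.
residue : ∀ s .{{_ : NonZero s}} m {r} → r < s → (m + (r + m * (s ∸ 1)) % s) % s ≡ r
residue s@(suc p) m {r} r<s = begin
  (m + X % s) % s               ≡⟨ %-distribˡ-+ m (X % s) s ⟩
  (m % s + X % s % s) % s       ≡⟨ cong (λ z → (m % s + z) % s) (m%n%n≡m%n X s) ⟩
  (m % s + X % s) % s           ≡⟨ %-distribˡ-+ m X s ⟨
  -- As `p` is `s ∸ 1`, the product `m * p` cancels `m` modulo `s`.
  (m + X) % s                   ≡⟨ cong (_% s) (solve 3 (λ m r p → m :+ (r :+ m :* p) := r :+ m :* (con 1 :+ p)) refl m r p) ⟩
  (r + m * s) % s               ≡⟨ [m+kn]%n≡m%n r m s ⟩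
  r % s                         ≡⟨ m<n⇒m%n≡m r<s ⟩
  r                             ∎
  where
  open ≡-Reasoning
  open +-*-Solver
  X : ℕ
  X = r + m * p

-- Leaves and internal vertices

module Degrees {n} (F : Graph n) (deg≢2 : ∀ v → deg F v ≢ 2) (deg≢0 : ∀ v → deg F v ≢ 0) where

  leaf : Fin n → Bool
  leaf v = does (deg F v ≟ 1)

  deg≡cnt : ∀ v → deg F v ≡ cnt (adj F v)
  deg≡cnt v = trans (sum-allFin (λ u → [ adj F v u ])) (≡-sym (cnt≡sum (adj F v)))

  n₁≡cnt : n₁ F ≡ cnt leaf
  n₁≡cnt = length-filter-allFin (λ v → deg F v ≟ 1)

  leaf-deg : ∀ {v} → leaf v ≡ true → cnt (adj F v) ≡ 1
  leaf-deg {v} lf = trans (≡-sym (deg≡cnt v)) (witness (deg F v ≟ 1) lf)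

  internal-deg : ∀ {v} → leaf v ≡ false → 3 ≤ cnt (adj F v)
  internal-deg {v} int = subst (3 ≤_) (deg≡cnt v) (go (deg F v) (deg≢0 v) (refutation (deg F v ≟ 1) int) (deg≢2 v))
    where
    go : ∀ d → d ≢ 0 → d ≢ 1 → d ≢ 2 → 3 ≤ d
    go 0 a b c = contradiction refl a
    go 1 a b c = contradiction refl b
    go 2 a b c = contradiction refl c
    go (suc (suc (suc d))) a b c = s≤s (s≤s (s≤s z≤n))

  neighbour : ∀ v → ∃ λ w → adj F v w ≡ true
  neighbour v = cnt-∃ (adj F v) (n≢0⇒n>0 λ e → deg≢0 v (trans (deg≡cnt v) e))

  -- An arbitrary neighbour; for a leaf it is the only one.
  hub : Fin n → Fin n
  hub v = proj₁ (neighbour v)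

  adj-hub : ∀ v → adj F v (hub v) ≡ true
  adj-hub v = proj₂ (neighbour v)

  hub-unique : ∀ {u w} → leaf u ≡ true → adj F u w ≡ true → w ≡ hub u
  hub-unique {u} lf uw = cnt≤1⇒≡ (adj F u) (≤-reflexive (leaf-deg lf)) uw (adj-hub u)

  hub-unique′ : ∀ {u w} → leaf u ≡ true → adj F w u ≡ true → w ≡ hub u
  hub-unique′ lf wu = hub-unique lf (adj-sym F wu)

module Labelling {n} (F : Graph n) (deg≢2 : ∀ v → deg F v ≢ 2) (deg≢0 : ∀ v → deg F v ≢ 0) where
  open Degrees F deg≢2 deg≢0

  small : ℕ → (Fin n → ℕ) → Fin n → Bool
  small s t w = leaf w ∧ does (t w ≤? s)

  -- The number b of edges from `v` to internal vertices and to leaves with `t` above `s`; for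
  -- internal `v` these get the label `s`.
  bigs : ℕ → (Fin n → ℕ) → Fin n → ℕ
  bigs s t v = cnt (λ w → adj F v w ∧ not (small s t w))

  high : ℕ → (Fin n → ℕ) → Fin n → Bool
  high s t v = not (leaf v) ∧ does (3 ≤? bigs s t v)

  -- The demands on the leaf weights `t`. A leaf weight is a sum of two labels, hence between `2`
  -- and `s + s`; `high≤s` provides a separate residue modulo `s` for each high vertex.
  record Ranking (s : ℕ) : Set where
    field
      t      : Fin n → ℕ
      t-low  : ∀ {u} → leaf u ≡ true → 2 ≤ t u
      t-high : ∀ {u} → leaf u ≡ true → t u ≤ s + s
      t-inj  : ∀ {u w} → leaf u ≡ true → leaf w ≡ true → t u ≡ t w → u ≡ w
      -- The edge of a K₂ is shared, so its two leaves must have close weights.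
      t-K₂   : ∀ {u w} → leaf u ≡ true → leaf w ≡ true → adj F u w ≡ true → t w ≤ suc (t u)
      bigs≥1 : ∀ {v} → leaf v ≡ false → 1 ≤ bigs s t v
      high≤s : cnt (high s t) ≤ s

  module Construction (s : ℕ) .{{_ : NonZero s}} (R : Ranking s) where
    open Ranking R

    sm : Fin n → Bool
    sm = small s t
    b j : Fin n → ℕ
    b = bigs s t
    j v = cnt (λ w → adj F v w ∧ sm w)

    1≤s : 1 ≤ s
    1≤s = >-nonZero⁻¹ s

    sm-leaf : ∀ {w} → sm w ≡ true → leaf w ≡ true
    sm-leaf = ∧-elimˡ
    sm-≤ : ∀ {w} → sm w ≡ true → t w ≤ s
    sm-≤ {w} p = witness (t w ≤? s) (∧-elimʳ {leaf w} p)

    deg-split : ∀ v → cnt (adj F v) ≡ j v + b v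
    deg-split v = cnt-split (adj F v) sm

    -- A low vertex `v` is to have weight `s + s + t a`. For b = 2 its edges contribute
    -- `s + s + j v`, so `j v < t a` leaves a positive label for `v`.
    Apex : Fin n → Fin n → Set
    Apex v a = (adj F v a ∧ sm a ≡ true) × j v < t a

    apex? : ∀ v → Dec (∃ (Apex v))
    apex? v = Fin.any? λ a → (adj F v a ∧ sm a Data.Bool.≟ true) ×-dec (j v <? t a)

    -- Pigeonhole: the j v small leaves at v have distinct t-values, all at least 2.
    apex-exists : ∀ v → 1 ≤ j v → ∃ (Apex v)
    apex-exists v 1≤j with apex? v
    ... | yes p  = p
    ... | no ¬p = contradiction (cnt-interval _ t 2 (pred (j v)) bounds inj) (<⇒≱ pred<)
      where
      pred< : pred (j v) < j v
      pred< = ≤-reflexive (suc-pred (j v) {{>-nonZero 1≤j}})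
      bounds : ∀ a → adj F v a ∧ sm a ≡ true → 2 ≤ t a × t a < 2 + pred (j v)
      bounds a q = t-low (sm-leaf (∧-elimʳ {adj F v a} q)) ,
        s≤s (≤-trans (≮⇒≥ λ lt → ¬p (a , q , lt)) (≤-reflexive (≡-sym (suc-pred (j v) {{>-nonZero 1≤j}}))))
      inj : ∀ x y → adj F v x ∧ sm x ≡ true → adj F v y ∧ sm y ≡ true → t x ≡ t y → x ≡ y
      inj x y p q = t-inj (sm-leaf (∧-elimʳ {adj F v x} p)) (sm-leaf (∧-elimʳ {adj F v y} q))

    apex : Fin n → Fin n
    apex v with apex? v
    ... | yes (a , _) = a
    -- A placeholder: for `1 ≤ j v` this case does not occur.
    ... | no _        = v

    apex-spec : ∀ v → 1 ≤ j v → Apex v (apex v)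
    apex-spec v 1≤j with apex? v
    ... | yes (a , p) = p
    ... | no ¬p      = contradiction (apex-exists v 1≤j) ¬p

    -- If the hub `v` has b = 1 and all its small leaves had edges labelled 1, its weight would be
    -- at most `s + s + j v`, short of the target. The edge at the apex makes up the difference.
    special : Fin n → Bool
    special u = (does (b (hub u) ≟ 1) ∧ not (leaf (hub u))) ∧ does (u Fin.≟ apex (hub u))

    -- The label of an edge is the smaller of the values g at its two ends.
    g : Fin n → ℕ
    g w = if sm w then (if special w then t w ∸ 1 else 1) else s

    g-bounds : ∀ w → 1 ≤ g w × g w ≤ s
    g-bounds w with sm w in eq
    ... | false = 1≤s , ≤-refl
    ... | true with special w
    ...   | true  = ∸-monoˡ-≤ 1 (t-low (sm-leaf eq)) , ≤-trans (m∸n≤m (t w) 1) (sm-≤ eq)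
    ...   | false = ≤-refl , 1≤s

    e : Fin n → Fin n → ℕ
    e u w = g u ⊓ g w

    e≥1 : ∀ u w → 1 ≤ e u w
    e≥1 u w = ⊓-glb (proj₁ (g-bounds u)) (proj₁ (g-bounds w))

    e≤s : ∀ u w → e u w ≤ s
    e≤s u w = ≤-trans (m⊓n≤m (g u) (g w)) (proj₂ (g-bounds u))

    base : Fin n → ℕ
    base v = sum (λ w → if adj F v w then e v w else 0)

    base-leaf : ∀ {v} → leaf v ≡ true → base v ≡ e v (hub v)
    base-leaf {v} lf = trans (sum-single _ (hub v) other) (cong (λ z → if z then e v (hub v) else 0) (adj-hub v))
      where
      other : ∀ w → w ≢ hub v → (if adj F v w then e v w else 0) ≡ 0
      other w w≢ with adj F v w in eq
      ... | false = refl
      ... | true  = contradiction (hub-unique lf eq) w≢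

    g-big : ∀ {w} → sm w ≡ false → g w ≡ s
    g-big q rewrite q = refl

    -- At a leaf, `g` is `s` if `s < t v`, and otherwise `t v ∸ 1` or 1. Each leaves a positive
    -- label for the leaf itself.
    g<t : ∀ {v} → leaf v ≡ true → g v < t v
    g<t {v} lf with sm v in eq
    ... | false = ≰⇒> λ le → false≢true eq (∧-intro lf (dec-true (t v ≤? s) le))
    ... | true with special v
    ...   | true  = ≤-reflexive (suc-pred (t v) {{>-nonZero (≤-trans (s≤s z≤n) (t-low lf))}})
    ...   | false = t-low lf

    t≤g+s : ∀ {v} → leaf v ≡ true → t v ≤ g v + s
    t≤g+s {v} lf with true? (sm v)
    ... | inj₁ p = ≤-trans (sm-≤ p) (m≤n+m s (g v))
    ... | inj₂ q = subst (λ z → t v ≤ z + s) (≡-sym (g-big q)) (t-high lf)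

    -- If the hub is a small leaf, the two form a K₂ and `t-K₂` gives `t v ≤ 1 + s`. In all other
    -- cases `g (hub v)` is `s`.
    t≤g-hub+s : ∀ {v} → leaf v ≡ true → t v ≤ g (hub v) + s
    t≤g-hub+s {v} lf with true? (sm (hub v))
    ... | inj₁ p = ≤-trans (t-K₂ (sm-leaf p) lf (adj-sym F (adj-hub v)))
                     (≤-trans (s≤s (sm-≤ p)) (+-monoˡ-≤ s (proj₁ (g-bounds (hub v)))))
    ... | inj₂ q = subst (λ z → t v ≤ z + s) (≡-sym (g-big q)) (t-high lf)

    e<t : ∀ {v} → leaf v ≡ true → e v (hub v) < t v
    e<t {v} lf = <-≤-trans (s≤s (m⊓n≤m (g v) (g (hub v)))) (g<t lf)

    t≤e+s : ∀ {v} → leaf v ≡ true → t v ≤ e v (hub v) + s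
    t≤e+s {v} lf = subst (t v ≤_) (≡-sym (+-distribʳ-⊓ s (g v) (g (hub v)))) (⊓-glb (t≤g+s lf) (t≤g-hub+s lf))

    special⇒ : ∀ {v w} → adj F v w ∧ sm w ≡ true → special w ≡ true → b v ≡ 1 × w ≡ apex v
    special⇒ {v} {w} q sp = witness (b v ≟ 1) (subst (λ z → does (b z ≟ 1) ≡ true) (≡-sym v≡hub) (∧-elimˡ (∧-elimˡ sp)))
                          , trans (witness (w Fin.≟ apex (hub w)) (∧-elimʳ {does (b (hub w) ≟ 1) ∧ _} sp)) (cong apex (≡-sym v≡hub))
      where
      v≡hub : v ≡ hub w
      v≡hub = hub-unique′ (sm-leaf (∧-elimʳ {adj F v w} q)) (∧-elimˡ q)

    special⇐ : ∀ {v} → leaf v ≡ false → b v ≡ 1 → 1 ≤ j v → special (apex v) ≡ true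
    special⇐ {v} int b≡1 1≤j = ∧-intro
      (∧-intro (dec-true (b (hub a) ≟ 1) (subst (λ z → b z ≡ 1) v≡hub b≡1))
               (subst (λ z → not (leaf z) ≡ true) v≡hub (cong not int)))
      (dec-true (a Fin.≟ apex (hub a)) (cong apex v≡hub))
      where
      a : Fin n
      a = apex v
      q : adj F v a ∧ sm a ≡ true
      q = proj₁ (apex-spec v 1≤j)
      v≡hub : v ≡ hub a
      v≡hub = hub-unique′ (sm-leaf (∧-elimʳ {adj F v a} q)) (∧-elimˡ q)

    -- The amount by which the labels of edges at small leaves exceed 1.
    surplus : Fin n → Fin n → ℕ
    surplus v w = if (adj F v w ∧ sm w) ∧ special w then t w ∸ 2 else 0

    surplus-one : ∀ {v} → leaf v ≡ false → 1 ≤ j v → b v ≡ 1 → sum (surplus v) ≡ t (apex v) ∸ 2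
    surplus-one {v} int 1≤j b≡1 = trans (sum-single (surplus v) (apex v) other)
      (cong (λ z → if z then t (apex v) ∸ 2 else 0) (∧-intro (proj₁ (apex-spec v 1≤j)) (special⇐ int b≡1 1≤j)))
      where
      other : ∀ w → w ≢ apex v → surplus v w ≡ 0
      other w w≢ with true? ((adj F v w ∧ sm w) ∧ special w)
      ... | inj₁ q = contradiction (proj₂ (special⇒ {v} {w} (∧-elimˡ q) (∧-elimʳ {adj F v w ∧ sm w} q))) w≢
      ... | inj₂ q = cong (λ z → if z then t w ∸ 2 else 0) q

    surplus-none : ∀ {v} → b v ≢ 1 → sum (surplus v) ≡ 0
    surplus-none {v} b≢1 = sum-zero other
      where
      other : ∀ w → surplus v w ≡ 0
      other w with true? ((adj F v w ∧ sm w) ∧ special w)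
      ... | inj₁ q = contradiction (proj₁ (special⇒ {v} {w} (∧-elimˡ q) (∧-elimʳ {adj F v w ∧ sm w} q))) b≢1
      ... | inj₂ q = cong (λ z → if z then t w ∸ 2 else 0) q

    -- Since `g v` is `s`, the label `e v w` is `g w`: 1 plus the surplus towards a small leaf, and
    -- `s` towards any other neighbour.
    base-internal : ∀ {v} → leaf v ≡ false → base v ≡ s * b v + (j v + sum (surplus v))
    base-internal {v} int = trans (sum-cong term) (trans (sum-+ _ _) (cong₂ _+_
      (trans (sum-*ˡ s _) (cong (s *_) (≡-sym (cnt≡sum _))))
      (trans (sum-+ (λ w → [ adj F v w ∧ sm w ]) (surplus v)) (cong (_+ sum (surplus v)) (≡-sym (cnt≡sum _))))))
      where
      e≡g : ∀ w → e v w ≡ g w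
      e≡g w = trans (cong (_⊓ g w) (g-big (cong (_∧ does (t v ≤? s)) int))) (m≥n⇒m⊓n≡n (proj₂ (g-bounds w)))
      term : ∀ w → (if adj F v w then e v w else 0) ≡
                   s * [ adj F v w ∧ not (sm w) ] + ([ adj F v w ∧ sm w ] + surplus v w)
      term w rewrite e≡g w with adj F v w
      ... | false = ≡-sym (trans (+-identityʳ (s * 0)) (*-zeroʳ s))
      ... | true with sm w in eq
      ...   | false = ≡-sym (trans (+-identityʳ (s * 1)) (*-identityʳ s))
      ...   | true rewrite *-zeroʳ s with special w
      ...     | true  = +-∸-assoc 1 (t-low (sm-leaf eq))
      ...     | false = refl

    index : Fin n → ℕ
    index = rank (high s t) toℕ

    -- The label that completes the edge sum to the intended weight: `t v` for a leaf, `s + s + t a`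
    -- for a low vertex with apex `a`, and for a high vertex one more than a number with residue
    -- `index v` modulo `s`.
    own : Fin n → ℕ
    own v = if leaf v then t v ∸ e v (hub v)
            else if does (3 ≤? b v) then suc ((index v + base v * (s ∸ 1)) % s)
            else if does (b v ≟ 1) then (2 + s) ∸ j v
            -- Here `b v` is 2, because `bigs≥1` excludes 0.
            else t (apex v) ∸ j v

    -- The kinds occupy disjoint ranges of weights: up to `s + s`, from there up to `s * 3`, and
    -- beyond.
    data Kind (v : Fin n) : Set where
      leafK : leaf v ≡ true → base v + own v ≡ t v → Kind v
      lowK  : ∀ a → adj F v a ≡ true → sm a ≡ true → base v + own v ≡ s + s + t a → Kind v
      highK : high s t v ≡ true → s * 3 < base v + own v →
              (base v + own v ∸ 1) % s ≡ index v → Kind v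

    Good : Fin n → Set
    Good v = Kind v × 1 ≤ own v × own v ≤ s

    good-leaf : ∀ {v} → leaf v ≡ true → Good v
    good-leaf {v} lf = leafK lf (trans (cong₂ _+_ (base-leaf lf) own≡) (m+[n∸m]≡n (<⇒≤ (e<t lf))))
                     , subst (λ z → 1 ≤ z × z ≤ s) (≡-sym own≡)
                         (m<n⇒0<n∸m (e<t lf) , m≤n+o⇒m∸n≤o (t v) (e v (hub v)) (t≤e+s lf))
      where
      own≡ : own v ≡ t v ∸ e v (hub v)
      own≡ rewrite lf = refl

    good-high : ∀ {v} → leaf v ≡ false → 3 ≤ b v → Good v
    good-high {v} int 3≤b = highK hi large (trans (cong (_% s) wt≡) (residue s (base v) (≤-trans (rank<cnt (high s t) toℕ hi) high≤s)))
                          , subst (λ z → 1 ≤ z × z ≤ s) (≡-sym own≡) (s≤s z≤n , m%n<n _ s)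
      where
      hi : high s t v ≡ true
      hi = ∧-intro (cong not int) (dec-true (3 ≤? b v) 3≤b)
      X : ℕ
      X = (index v + base v * (s ∸ 1)) % s
      own≡ : own v ≡ suc X
      own≡ rewrite int | dec-true (3 ≤? b v) 3≤b = refl
      wt≡ : base v + own v ∸ 1 ≡ base v + X
      wt≡ = cong (_∸ 1) (trans (cong (base v +_) own≡) (+-suc (base v) X))
      large : s * 3 < base v + own v
      large = begin-strict
        s * 3             ≤⟨ *-monoʳ-≤ s 3≤b ⟩
        s * b v           ≤⟨ m≤m+n _ _ ⟩
        _                 ≡⟨ base-internal int ⟨
        base v            <⟨ m<m+n (base v) (subst (0 <_) (≡-sym own≡) (s≤s z≤n)) ⟩
        base v + own v    ∎
        where open ≤-Reasoning

    module _ {v} (int : leaf v ≡ false) (b≤2 : b v ≤ 2) where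
      -- The degree is at least 3, and at most two neighbours are not small leaves.
      1≤j : 1 ≤ j v
      1≤j = +-cancelʳ-≤ 2 1 (j v) (≤-trans (subst (3 ≤_) (deg-split v) (internal-deg int)) (+-monoʳ-≤ (j v) b≤2))

      a : Fin n
      a = apex v

      adj-a : adj F v a ≡ true
      adj-a = ∧-elimˡ (proj₁ (apex-spec v 1≤j))

      sm-a : sm a ≡ true
      sm-a = ∧-elimʳ {adj F v a} (proj₁ (apex-spec v 1≤j))

      j<t : j v < t a
      j<t = proj₂ (apex-spec v 1≤j)

      not-high : does (3 ≤? b v) ≡ false
      not-high = dec-false (3 ≤? b v) (<⇒≱ (s≤s b≤2))

      good-one : b v ≡ 1 → Good v
      good-one b≡1 = lowK a adj-a sm-a (trans (cong₂ _+_ (base-internal int) own≡) wt≡)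
                   , subst (λ z → 1 ≤ z × z ≤ s) (≡-sym own≡)
                       (m<n⇒0<n∸m (≤-trans (≤-trans j<t (sm-≤ sm-a)) (m≤n+m s 2))
                       , ∸-monoʳ-≤ (2 + s) 2≤j)
        where
        -- This keeps the own label `(2 + s) ∸ j v` at most `s`.
        2≤j : 2 ≤ j v
        2≤j = +-cancelʳ-≤ 1 2 (j v) (subst (λ z → 3 ≤ j v + z) b≡1 (subst (3 ≤_) (deg-split v) (internal-deg int)))
        own≡ : own v ≡ (2 + s) ∸ j v
        own≡ rewrite int | not-high | dec-true (b v ≟ 1) b≡1 = refl
        j≤2+s : j v ≤ 2 + s
        j≤2+s = ≤-trans (<⇒≤ j<t) (≤-trans (sm-≤ sm-a) (m≤n+m s 2))
        wt≡ : s * b v + (j v + sum (surplus v)) + ((2 + s) ∸ j v) ≡ s + s + t a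
        wt≡ = begin
          s * b v + (j v + sum (surplus v)) + ((2 + s) ∸ j v)
            ≡⟨ cong₂ (λ y z → s * y + (j v + z) + ((2 + s) ∸ j v)) b≡1
                     (surplus-one int 1≤j b≡1) ⟩
          s * 1 + (j v + (t a ∸ 2)) + ((2 + s) ∸ j v)
            ≡⟨ solve 4 (λ s j x y → s :* con 1 :+ (j :+ x) :+ y := s :+ (j :+ y) :+ x) refl s (j v) (t a ∸ 2) _ ⟩
          s + (j v + ((2 + s) ∸ j v)) + (t a ∸ 2)
            ≡⟨ cong (λ z → s + z + (t a ∸ 2)) (m+[n∸m]≡n j≤2+s) ⟩
          s + (2 + s) + (t a ∸ 2)
            ≡⟨ solve 2 (λ s x → s :+ (con 2 :+ s) :+ x := s :+ s :+ (con 2 :+ x)) refl s (t a ∸ 2) ⟩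
          s + s + (2 + (t a ∸ 2))
            ≡⟨ cong (s + s +_) (m+[n∸m]≡n (t-low (sm-leaf sm-a))) ⟩
          s + s + t a ∎
          where
          open ≡-Reasoning
          open +-*-Solver

      good-two : b v ≡ 2 → Good v
      good-two b≡2 = lowK a adj-a sm-a (trans (cong₂ _+_ (base-internal int) own≡) wt≡)
                   , subst (λ z → 1 ≤ z × z ≤ s) (≡-sym own≡)
                       (m<n⇒0<n∸m j<t , ≤-trans (m∸n≤m (t a) (j v)) (sm-≤ sm-a))
        where
        b≢1 : b v ≢ 1
        b≢1 b≡1 = contradiction (trans (≡-sym b≡1) b≡2) λ ()
        own≡ : own v ≡ t a ∸ j v
        own≡ rewrite int | not-high | dec-false (b v ≟ 1) b≢1 = refl
        wt≡ : s * b v + (j v + sum (surplus v)) + (t a ∸ j v) ≡ s + s + t a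
        wt≡ = begin
          s * b v + (j v + sum (surplus v)) + (t a ∸ j v)
            ≡⟨ cong₂ (λ y z → s * y + (j v + z) + (t a ∸ j v)) b≡2
                     (surplus-none b≢1) ⟩
          s * 2 + (j v + 0) + (t a ∸ j v)
            ≡⟨ solve 3 (λ s j y → s :* con 2 :+ (j :+ con 0) :+ y := s :+ s :+ (j :+ y)) refl s (j v) _ ⟩
          s + s + (j v + (t a ∸ j v))
            ≡⟨ cong (s + s +_) (m+[n∸m]≡n (<⇒≤ j<t)) ⟩
          s + s + t a ∎
          where
          open ≡-Reasoning
          open +-*-Solver

    good : ∀ v → Good v
    good v with true? (leaf v)
    ... | inj₁ lf = good-leaf lf
    ... | inj₂ int with 3 ≤? b v | <-cmp (b v) 2
    ...   | yes 3≤b | _ = good-high int 3≤b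
    ...   | no 3≰b  | tri< b<2 _ _ = good-one int (<⇒≤ b<2) (≤-antisym (≤-pred b<2) (bigs≥1 int))
    ...   | no 3≰b  | tri≈ _ b≡2 _ = good-two int (≤-reflexive b≡2) b≡2
    ...   | no 3≰b  | tri> _ _ b>2 = contradiction b>2 3≰b

    weighting : TotalWeighting F s
    weighting = record
      { wv = own
      ; we = e
      ; we-sym = λ u v _ → ⊓-comm (g u) (g v)
      ; wv-low = λ v → proj₁ (proj₂ (good v))
      ; wv-high = λ v → proj₂ (proj₂ (good v))
      ; we-low = λ u v _ → e≥1 u v
      ; we-high = λ u v _ → e≤s u v
      }

    wt≡ : ∀ v → wt weighting v ≡ base v + own v
    wt≡ v = trans (cong (own v +_) (sum-allFin _)) (+-comm (own v) (base v))

    s+s+t≤s*3 : ∀ {a} → sm a ≡ true → s + s + t a ≤ s * 3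
    s+s+t≤s*3 {a} p = ≤-trans (+-monoʳ-≤ (s + s) (sm-≤ p))
      (≤-reflexive (solve 1 (λ s → s :+ s :+ s := s :* con 3) refl s))
      where open +-*-Solver

    s+s<s+s+t : ∀ {a} → sm a ≡ true → s + s < s + s + t a
    s+s<s+s+t p = m<m+n (s + s) (≤-trans (s≤s z≤n) (t-low (sm-leaf p)))

    s+s≤s*3 : s + s ≤ s * 3
    s+s≤s*3 = ≤-trans (m≤m+n (s + s) s) (≤-reflexive (solve 1 (λ s → s :+ s :+ s := s :* con 3) refl s))
      where open +-*-Solver

    -- Different kinds have disjoint ranges. Within a kind, the weight determines a leaf by `t`, a
    -- low vertex as the hub of its apex, and a high vertex by its index.
    distinct : ∀ {u v} → Kind u → Kind v → base u + own u ≡ base v + own v → u ≡ v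
    distinct (leafK lu p) (leafK lv q) eq = t-inj lu lv (trans (≡-sym p) (trans eq q))
    distinct (leafK lu p) (lowK a _ sa q) eq =
      contradiction (trans (≡-sym p) (trans eq q)) (<⇒≢ (≤-<-trans (t-high lu) (s+s<s+s+t sa)))
    distinct (leafK lu p) (highK _ q _) eq =
      contradiction (trans (≡-sym p) eq) (<⇒≢ (≤-<-trans (≤-trans (t-high lu) s+s≤s*3) q))
    distinct (lowK a va sa p) (lowK a′ va′ sa′ p′) eq
      with t-inj (sm-leaf sa) (sm-leaf sa′) (+-cancelˡ-≡ (s + s) _ _ (trans (≡-sym p) (trans eq p′)))
    ... | refl = trans (hub-unique′ (sm-leaf sa) va) (≡-sym (hub-unique′ (sm-leaf sa) va′))
    distinct (lowK a va sa p) (highK _ q _) eq =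
      contradiction (trans (≡-sym p) eq) (<⇒≢ (≤-<-trans (s+s+t≤s*3 sa) q))
    distinct (highK hu _ p) (highK hv _ q) eq =
      Fin.toℕ-injective (rank-reflects-≡ (high s t) toℕ hu hv
        (trans (≡-sym p) (trans (cong (λ z → (z ∸ 1) % s) eq) q)))
    distinct ku@(lowK _ _ _ _)  kv@(leafK _ _) eq = ≡-sym (distinct kv ku (≡-sym eq))
    distinct ku@(highK _ _ _)   kv@(leafK _ _) eq = ≡-sym (distinct kv ku (≡-sym eq))
    distinct ku@(highK _ _ _)   kv@(lowK _ _ _ _) eq = ≡-sym (distinct kv ku (≡-sym eq))

    irregular : Irregular weighting
    irregular u v u≢v eq = u≢v (distinct (proj₁ (good u)) (proj₁ (good v)) (trans (≡-sym (wt≡ u)) (trans eq (wt≡ v))))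

-- The ranking

-- For `x` below `n`, the number `a * n + x` encodes the pair `(a , x)` in lexicographic order.
lex-< : ∀ {n a b x y} → x < n → a < b → a * n + x < b * n + y
lex-< {n} {a} {b} {x} {y} x<n a<b = begin-strict
  a * n + x   <⟨ +-monoʳ-< (a * n) x<n ⟩
  a * n + n   ≡⟨ +-comm (a * n) n ⟩
  suc a * n   ≤⟨ *-monoˡ-≤ n a<b ⟩
  b * n       ≤⟨ m≤m+n _ y ⟩
  b * n + y   ∎
  where open ≤-Reasoning

lex-≤ : ∀ {n a b x y} → y < n → a * n + x ≤ b * n + y → a ≤ b
lex-≤ {a = a} {b} y<n le = ≮⇒≥ λ b<a → <⇒≱ (lex-< y<n b<a) le

cnt-except : ∀ {n} (P : Fin n → Bool) u → cnt P ≤ suc (cnt (λ v → P v ∧ not (does (v Fin.≟ u))))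
cnt-except P u = ≤-trans (≤-reflexive (cnt-split P (λ v → does (v Fin.≟ u))))
  (+-monoˡ-≤ _ (≤-trans (cnt-mono λ v → ∧-elimʳ {P v}) (≤-reflexive (cnt-≟ u))))

≟-elim : ∀ {n} {u w : Fin n} → not (does (w Fin.≟ u)) ≡ true → w ≢ u
≟-elim {u = u} {w} p w≡u = not-elim p (dec-true (w Fin.≟ u) w≡u)

not-false : ∀ {b} → b ≡ false → not b ≡ true
not-false refl = refl

not-true : ∀ {b} → not b ≡ true → b ≡ false
not-true {false} _ = refl

¬∨-elim : ∀ {a b} → ¬ (not a ∨ b ≡ true) → a ≡ true × ¬ (b ≡ true)
¬∨-elim {true}  h = refl , h
¬∨-elim {false} h = contradiction refl h

∨-introʳ : ∀ a {b} → b ≡ true → a ∨ b ≡ true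
∨-introʳ true  _ = refl
∨-introʳ false q = q

-- The two bounds say that `s + s` is `n₁ + 1` or `n₁ + 2`.
module Order {n} (F : Graph n) (acyclic : Forest F)
             (deg≢2 : ∀ v → deg F v ≢ 2) (deg≢0 : ∀ v → deg F v ≢ 0)
             (s : ℕ) (s-low : cnt (Degrees.leaf F deg≢2 deg≢0) < s + s)
             (s-high : s + s ≤ 2 + cnt (Degrees.leaf F deg≢2 deg≢0)) where
  open Degrees F deg≢2 deg≢0
  open Labelling F deg≢2 deg≢0

  -- Leaves u with class 0 come first: their hub keeps two edges labelled s even if u and all
  -- preceding leaves at the hub are small.  In class 2, last, is the final leaf of each star.  Both
  -- leaves of a K₂ have class 1, and `lesser' makes them adjacent in the ranking.
  after : Fin n → ℕ
  after u = cnt (λ w → adj F (hub u) w ∧ (not (leaf w) ∨ does (toℕ u <? toℕ w)))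

  class lesser key t : Fin n → ℕ
  class u = if leaf (hub u) then 1 else 2 ∸ after u
  lesser u = toℕ u ⊓ toℕ (hub u)
  -- Compares first by class, then by `lesser`, then by vertex number.
  key u = (class u * n + lesser u) * n + toℕ u
  t u = 2 + rank leaf key u

  class-leaf : ∀ {u} → leaf (hub u) ≡ true → class u ≡ 1
  class-leaf p rewrite p = refl

  class-internal : ∀ {u} → leaf (hub u) ≡ false → class u ≡ 2 ∸ after u
  class-internal p rewrite p = refl

  lesser<n : ∀ u → lesser u < n
  lesser<n u = ≤-trans (s≤s (m⊓n≤m (toℕ u) _)) (Fin.toℕ<n u)

  key-class : ∀ {u w} → class u < class w → key u < key w
  key-class {u} {w} lt = lex-< (Fin.toℕ<n u) (lex-< {a = class u} {class w} (lesser<n u) lt)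

  key-≤ : ∀ {u w} → key u ≤ key w → class u * n + lesser u ≤ class w * n + lesser w
  key-≤ {u} {w} le = lex-≤ {x = toℕ u} (Fin.toℕ<n w) le

  key-injective : ∀ {u w} → key u ≡ key w → u ≡ w
  key-injective {u} {w} eq = Fin.toℕ-injective (+-cancelˡ-≡ ((class u * n + lesser u) * n) _ _
    (trans eq (cong (λ z → z * n + toℕ w) (≡-sym prefix))))
    where
    prefix : class u * n + lesser u ≡ class w * n + lesser w
    prefix = ≤-antisym (key-≤ {u} {w} (≤-reflexive eq)) (key-≤ {w} {u} (≤-reflexive (≡-sym eq)))

  t-high : ∀ {u} → leaf u ≡ true → t u ≤ s + s
  t-high lf = ≤-trans (s≤s (rank<cnt leaf key lf)) s-low

  t-inj : ∀ {u w} → leaf u ≡ true → leaf w ≡ true → t u ≡ t w → u ≡ w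
  t-inj lu lw eq = key-injective (rank-reflects-≡ leaf key lu lw (+-cancelˡ-≡ 2 _ _ eq))

  small-class : ∀ {u w} → leaf u ≡ true → class u < class w → small s t w ≡ true → small s t u ≡ true
  small-class {u} {w} lu lt sw = ∧-intro lu (dec-true (t u ≤? s)
    (≤-trans (+-monoʳ-≤ 2 (<⇒≤ (rank-mono-< leaf key lu (key-class lt)))) (witness (t w ≤? s) (∧-elimʳ {leaf w} sw))))

  -- Both leaves of a K₂ agree in class and `lesser`, so `x` agrees with them too. Hence `x` or its
  -- hub is `u` or `w`.
  between : ∀ {u w x} → leaf u ≡ true → leaf w ≡ true → adj F u w ≡ true →
            leaf x ≡ true → key u ≤ key x → key x ≤ key w → x ≡ u ⊎ x ≡ w
  between {u} {w} {x} lu lw uw lx u≤x x≤w = go (⊓-sel (toℕ x) (toℕ (hub x))) (⊓-sel (toℕ u) (toℕ w))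
    where
    w≡hub : w ≡ hub u
    w≡hub = hub-unique lu uw
    u≡hub : u ≡ hub w
    u≡hub = hub-unique lw (adj-sym F uw)
    class≡ : class u ≡ class w
    class≡ = trans (class-leaf (subst (λ z → leaf z ≡ true) w≡hub lw))
                   (≡-sym (class-leaf (subst (λ z → leaf z ≡ true) u≡hub lu)))
    lesser-u : lesser u ≡ toℕ u ⊓ toℕ w
    lesser-u = cong (λ z → toℕ u ⊓ toℕ z) (≡-sym w≡hub)
    lesser≡ : lesser u ≡ lesser w
    lesser≡ = trans lesser-u (trans (⊓-comm (toℕ u) (toℕ w)) (cong (λ z → toℕ w ⊓ toℕ z) u≡hub))
    prefix : class u * n + lesser u ≡ class x * n + lesser x
    prefix = ≤-antisym (key-≤ {u} {x} u≤x)
      (≤-trans (key-≤ {x} {w} x≤w) (≤-reflexive (cong₂ (λ y z → y * n + z) (≡-sym class≡) (≡-sym lesser≡))))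
    class-x : class u ≡ class x
    class-x = ≤-antisym (lex-≤ {a = class u} (lesser<n x) (≤-reflexive prefix))
                        (lex-≤ {a = class x} (lesser<n u) (≤-reflexive (≡-sym prefix)))
    lesser-x : lesser x ≡ toℕ u ⊓ toℕ w
    lesser-x = trans (≡-sym (+-cancelˡ-≡ (class u * n) _ _ (trans prefix (cong (λ z → z * n + lesser x) (≡-sym class-x))))) lesser-u
    go : lesser x ≡ toℕ x ⊎ lesser x ≡ toℕ (hub x) → toℕ u ⊓ toℕ w ≡ toℕ u ⊎ toℕ u ⊓ toℕ w ≡ toℕ w → x ≡ u ⊎ x ≡ w
    go (inj₁ p) (inj₁ q) = inj₁ (Fin.toℕ-injective (trans (≡-sym p) (trans lesser-x q)))
    go (inj₁ p) (inj₂ q) = inj₂ (Fin.toℕ-injective (trans (≡-sym p) (trans lesser-x q)))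
    go (inj₂ p) (inj₁ q) = inj₂ (trans (hub-unique lu (adj-sym F (subst (λ z → adj F x z ≡ true) hub≡ (adj-hub x)))) (≡-sym w≡hub))
      where
      hub≡ : hub x ≡ u
      hub≡ = Fin.toℕ-injective (trans (≡-sym p) (trans lesser-x q))
    go (inj₂ p) (inj₂ q) = inj₁ (trans (hub-unique lw (adj-sym F (subst (λ z → adj F x z ≡ true) hub≡ (adj-hub x)))) (≡-sym u≡hub))
      where
      hub≡ : hub x ≡ w
      hub≡ = Fin.toℕ-injective (trans (≡-sym p) (trans lesser-x q))

  -- By `between`, only `u` itself can precede `w` without preceding `u`.
  t-K₂ : ∀ {u w} → leaf u ≡ true → leaf w ≡ true → adj F u w ≡ true → t w ≤ suc (t u)
  t-K₂ {u} {w} lu lw uw = s≤s (s≤s (≤-trans (cnt-except _ u) (s≤s (cnt-mono step))))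
    where
    step : ∀ x → (leaf x ∧ does (key x <? key w)) ∧ not (does (x Fin.≟ u)) ≡ true → leaf x ∧ does (key x <? key u) ≡ true
    step x q = ∧-intro lx (dec-true (key x <? key u) (≰⇒> not-between))
      where
      lx : leaf x ≡ true
      lx = ∧-elimˡ (∧-elimˡ q)
      x<w : key x < key w
      x<w = witness (key x <? key w) (∧-elimʳ {leaf x} (∧-elimˡ q))
      not-between : ¬ (key u ≤ key x)
      not-between le with between lu lw uw lx le (<⇒≤ x<w)
      ... | inj₁ x≡u = ≟-elim (∧-elimʳ {leaf x ∧ does (key x <? key w)} q) x≡u
      ... | inj₂ refl = <-irrefl refl x<w

  -- The last leaves of stars

  class2 class<2 : Fin n → Bool
  class<2 u = leaf u ∧ does (class u <? 2)
  class2 u = leaf u ∧ not (does (class u <? 2))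

  class≥2 : ∀ {u} → 2 ≤ class u → leaf (hub u) ≡ false × after u ≡ 0
  class≥2 {u} le with true? (leaf (hub u))
  ... | inj₁ p = contradiction (subst (2 ≤_) (class-leaf p) le) λ { (s≤s ()) }
  ... | inj₂ p = p , go (after u) (subst (2 ≤_) (class-internal p) le)
    where
    go : ∀ a → 2 ≤ 2 ∸ a → a ≡ 0
    go zero _ = refl
    go (suc zero) (s≤s ())
    go (suc (suc zero)) ()
    go (suc (suc (suc a))) ()

  -- The component is then a star whose last leaf is `u`.
  after-zero : ∀ {u} → after u ≡ 0 → ∀ {w} → adj F (hub u) w ≡ true → leaf w ≡ true × toℕ w ≤ toℕ u
  after-zero {u} az {w} hw = proj₁ neither , ≮⇒≥ λ lt → proj₂ neither (dec-true (toℕ u <? toℕ w) lt)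
    where
    neither : leaf w ≡ true × ¬ (does (toℕ u <? toℕ w) ≡ true)
    neither = ¬∨-elim λ p → contradiction (subst (1 ≤_) az (cnt-pos _ (∧-intro hw p))) λ ()

  sibling-exists : ∀ u → leaf (hub u) ≡ false → ∃ λ w → adj F (hub u) w ≡ true × w ≢ u
  sibling-exists u int = other-neighbour F (λ _ → true) (hub u) u (<⇒≤ (internal-deg int))

  sibling : Fin n → Fin n
  sibling u with true? (leaf (hub u))
  -- A placeholder: leaves of class 2 have an internal hub.
  ... | inj₁ _   = u
  ... | inj₂ int = proj₁ (sibling-exists u int)

  sibling-spec : ∀ {u} → leaf (hub u) ≡ false → adj F (hub u) (sibling u) ≡ true × sibling u ≢ u
  sibling-spec {u} int with true? (leaf (hub u))
  ... | inj₁ lf   = contradiction lf (false≢true int)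
  ... | inj₂ int′ = proj₂ (sibling-exists u int′)

  -- A leaf of class 2 is the last of its star, and every other leaf of the star has lower class. A
  -- star has only one last leaf, so the choice of a sibling is injective.
  class2≤class<2 : cnt class2 ≤ cnt class<2
  class2≤class<2 = cnt-inject class2 class<2 sibling maps inj
    where
    last : ∀ {u} → class2 u ≡ true → leaf (hub u) ≡ false × after u ≡ 0
    last {u} p = class≥2 (≮⇒≥ λ lt → not-elim (∧-elimʳ {leaf u} p) (dec-true (class u <? 2) lt))
    hub-sibling : ∀ {u} → class2 u ≡ true → hub u ≡ hub (sibling u)
    hub-sibling {u} p = hub-unique′ (proj₁ (after-zero {u} (proj₂ (last p)) adj-sib)) adj-sib
      where
      adj-sib : adj F (hub u) (sibling u) ≡ true
      adj-sib = proj₁ (sibling-spec (proj₁ (last p)))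
    maps : ∀ u → class2 u ≡ true → class<2 (sibling u) ≡ true
    maps u p = ∧-intro (proj₁ below) (dec-true (class w <? 2) (subst (_< 2) (≡-sym (class-internal int-w)) (go (after w) after≥1)))
      where
      w : Fin n
      w = sibling u
      spec : adj F (hub u) w ≡ true × w ≢ u
      spec = sibling-spec (proj₁ (last p))
      below : leaf w ≡ true × toℕ w ≤ toℕ u
      below = after-zero {u} (proj₂ (last p)) (proj₁ spec)
      int-w : leaf (hub w) ≡ false
      int-w = subst (λ z → leaf z ≡ false) (hub-sibling p) (proj₁ (last p))
      after≥1 : 1 ≤ after w
      after≥1 = cnt-pos _ {u} (∧-intro (subst (λ z → adj F z u ≡ true) (hub-sibling p) (adj-sym F (adj-hub u)))
        (∨-introʳ (not (leaf u)) (dec-true (toℕ w <? toℕ u) (≤∧≢⇒< (proj₂ below) (proj₂ spec ∘ Fin.toℕ-injective)))))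
      go : ∀ a → 1 ≤ a → 2 ∸ a < 2
      go (suc a) _ = s≤s (m∸n≤m 1 a)
    inj : ∀ u v → class2 u ≡ true → class2 v ≡ true → sibling u ≡ sibling v → u ≡ v
    inj u v p q eq = Fin.toℕ-injective (≤-antisym
      (proj₂ (after-zero {v} (proj₂ (last q)) (subst (λ z → adj F z u ≡ true) hub≡ (adj-sym F (adj-hub u)))))
      (proj₂ (after-zero {u} (proj₂ (last p)) (subst (λ z → adj F z v ≡ true) (≡-sym hub≡) (adj-sym F (adj-hub v))))))
      where
      hub≡ : hub u ≡ hub v
      hub≡ = trans (hub-sibling p) (trans (cong hub eq) (≡-sym (hub-sibling q)))

  -- The leaves of lower class all precede `a` and make up at least half of the leaves. So twice
  -- `t a` is at least `4 + n₁`, which exceeds `s + s`.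
  class2⇒¬small : ∀ {a} → 2 ≤ class a → ¬ (small s t a ≡ true)
  class2⇒¬small {a} 2≤c sa = <-irrefl refl (begin-strict
    s + s                           ≤⟨ s-high ⟩
    2 + cnt leaf                    ≡⟨ cong (2 +_) (cnt-split leaf (λ u → does (class u <? 2))) ⟩
    2 + (cnt class<2 + cnt class2)  ≤⟨ +-monoʳ-≤ 2 (+-monoʳ-≤ (cnt class<2) class2≤class<2) ⟩
    2 + (cnt class<2 + cnt class<2) ≤⟨ +-monoʳ-≤ 2 (+-mono-≤ early early) ⟩
    2 + (rank leaf key a + rank leaf key a) <⟨ +-mono-<-≤ (m<m+n 2 {2} (s≤s z≤n)) ≤-refl ⟩
    4 + (rank leaf key a + rank leaf key a) ≡⟨ solve 1 (λ r → con 4 :+ (r :+ r) := (con 2 :+ r) :+ (con 2 :+ r)) refl (rank leaf key a) ⟩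
    t a + t a                       ≤⟨ +-mono-≤ ta≤s ta≤s ⟩
    s + s                           ∎)
    where
    open ≤-Reasoning
    open +-*-Solver
    ta≤s : t a ≤ s
    ta≤s = witness (t a ≤? s) (∧-elimʳ {leaf a} sa)
    early : cnt class<2 ≤ rank leaf key a
    early = cnt-mono λ u q → ∧-intro (∧-elimˡ q)
      (dec-true (key u <? key a) (key-class (<-≤-trans (witness (class u <? 2) (∧-elimʳ {leaf u} q)) 2≤c)))

  -- Otherwise all neighbours of `v` are small leaves, and the last of them has class 2.
  bigs≥1 : ∀ {v} → leaf v ≡ false → 1 ≤ bigs s t v
  bigs≥1 {v} int = ≰⇒> λ b≤0 → absurd (n≤0⇒n≡0 b≤0)
    where
    absurd : bigs s t v ≢ 0
    absurd b≡0 = class2⇒¬small (≤-reflexive (≡-sym class-a)) (all-small a va)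
      where
      all-small : ∀ w → adj F v w ≡ true → small s t w ≡ true
      all-small w vw with true? (small s t w)
      ... | inj₁ p = p
      ... | inj₂ p = contradiction (subst (1 ≤_) b≡0 (cnt-pos _ (∧-intro vw (not-false p)))) λ ()
      top : ∃ λ a → adj F v a ≡ true × (∀ i → adj F v i ≡ true → toℕ i ≤ toℕ a)
      top = argmax (adj F v) toℕ (neighbour v)
      a : Fin n
      a = proj₁ top
      va : adj F v a ≡ true
      va = proj₁ (proj₂ top)
      v≡hub : v ≡ hub a
      v≡hub = hub-unique′ (∧-elimˡ (all-small a va)) va
      class-a : class a ≡ 2
      class-a = trans (class-internal (subst (λ z → leaf z ≡ false) v≡hub int)) (cong (2 ∸_) (cnt-zero _ none))
        where
        none : ∀ w → ¬ (adj F (hub a) w ∧ (not (leaf w) ∨ does (toℕ a <? toℕ w)) ≡ true)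
        none w q = go (∧-elimˡ (all-small w vw)) (∧-elimʳ {adj F (hub a) w} q)
          where
          vw : adj F v w ≡ true
          vw = subst (λ z → adj F z w ≡ true) (≡-sym v≡hub) (∧-elimˡ q)
          go : leaf w ≡ true → ¬ (not (leaf w) ∨ does (toℕ a <? toℕ w) ≡ true)
          go lw r rewrite lw = <⇒≱ (witness (toℕ a <? toℕ w) r) (proj₂ (proj₂ top) w vw)

  -- The number of high vertices

  inner : Fin n → ℕ
  inner v = cnt (λ w → adj F v w ∧ not (leaf w))

  degree-split : ∀ v → cnt (adj F v) ≡ cnt (λ w → adj F v w ∧ leaf w) + inner v
  degree-split v = cnt-split (adj F v) leaf

  inner-ones inner≥3 : Fin n → Bool
  inner-ones v = not (leaf v) ∧ does (inner v ≟ 1)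
  inner≥3 v = not (leaf v) ∧ does (3 ≤? inner v)

  -- On `U` the value `inner` is at most the induced degree, whose average in a forest is at most 2.
  -- An excess over 2 must be offset by vertices with value 1.
  inner≥3≤inner-ones : cnt inner≥3 ≤ cnt inner-ones
  inner≥3≤inner-ones = +-cancelˡ-≤ (2 * cnt U) _ _ (begin
    2 * cnt U + cnt inner≥3
      ≡⟨ cong₂ _+_ (trans (cong (2 *_) (cnt≡sum U)) (≡-sym (sum-*ˡ 2 _))) (cnt≡sum inner≥3) ⟩
    sum (λ v → 2 * [ U v ]) + sum (λ v → [ inner≥3 v ])
      ≡⟨ sum-+ _ _ ⟨
    sum (λ v → 2 * [ U v ] + [ inner≥3 v ])
      ≤⟨ sum-mono pointwise ⟩
    sum (λ v → row v + [ inner-ones v ])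
      ≡⟨ trans (sum-+ row _) (cong (sum row +_) (≡-sym (cnt≡sum inner-ones))) ⟩
    sum row + cnt inner-ones
      ≤⟨ +-monoˡ-≤ _ (forest-degSum F acyclic U) ⟩
    2 * cnt U + cnt inner-ones ∎)
    where
    open ≤-Reasoning
    -- Internal vertices without internal neighbours are left out, since `count` fails at 0.
    U : Fin n → Bool
    U v = not (leaf v) ∧ does (1 ≤? inner v)
    row : Fin n → ℕ
    row v = cnt (λ w → U v ∧ U w ∧ adj F v w)
    count : ∀ i → 1 ≤ i → 2 + [ does (3 ≤? i) ] ≤ i + [ does (i ≟ 1) ]
    count 1 _ = ≤-refl
    count 2 _ = ≤-refl
    count (suc (suc (suc i))) _ = s≤s (s≤s (s≤s z≤n))
    pointwise : ∀ v → 2 * [ U v ] + [ inner≥3 v ] ≤ row v + [ inner-ones v ]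
    pointwise v = go (true? (leaf v)) (1 ≤? inner v)
      where
      go : leaf v ≡ true ⊎ leaf v ≡ false → Dec (1 ≤ inner v) → 2 * [ U v ] + [ inner≥3 v ] ≤ row v + [ inner-ones v ]
      go (inj₁ lf) _ = subst (λ z → 2 * [ not z ∧ does (1 ≤? inner v) ] + [ not z ∧ does (3 ≤? inner v) ] ≤ row v + [ inner-ones v ])
                         (≡-sym lf) z≤n
      go (inj₂ int) (no ¬1≤) = ≤-trans (≤-reflexive (cong₂ (λ y z → 2 * [ y ] + [ z ])
        (trans (cong (λ z → not z ∧ does (1 ≤? inner v)) int) (dec-false (1 ≤? inner v) ¬1≤))
        (trans (cong (λ z → not z ∧ does (3 ≤? inner v)) int) (dec-false (3 ≤? inner v) (λ p → ¬1≤ (≤-trans (s≤s z≤n) p)))))) z≤n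
      go (inj₂ int) (yes 1≤) = begin
        2 * [ U v ] + [ inner≥3 v ]
          ≡⟨ cong₂ (λ y z → 2 * [ y ] + [ not z ∧ does (3 ≤? inner v) ]) Uv int ⟩
        2 + [ does (3 ≤? inner v) ]                 ≤⟨ count (inner v) 1≤ ⟩
        inner v + [ does (inner v ≟ 1) ]            ≡⟨ cong (λ z → inner v + [ not z ∧ does (inner v ≟ 1) ]) int ⟨
        inner v + [ inner-ones v ]                  ≤⟨ +-monoˡ-≤ _ (cnt-mono sub) ⟩
        row v + [ inner-ones v ]                    ∎
        where
        Uv : U v ≡ true
        Uv = ∧-intro (not-false int) (dec-true (1 ≤? inner v) 1≤)
        sub : ∀ w → adj F v w ∧ not (leaf w) ≡ true → U v ∧ U w ∧ adj F v w ≡ true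
        sub w q = ∧-intro Uv (∧-intro (∧-intro (∧-elimʳ {adj F v w} q)
          (dec-true (1 ≤? inner w) (cnt-pos _ (∧-intro (adj-sym F (∧-elimˡ q)) (not-false int))))) (∧-elimˡ q))

  -- Degree at least 3 with one internal neighbour leaves two leaves, and a leaf hangs at only one
  -- vertex.
  inner-ones≤ : cnt inner-ones + cnt inner-ones ≤ cnt leaf
  inner-ones≤ = begin
    cnt inner-ones + cnt inner-ones
      ≡⟨ trans (cong₂ _+_ (cnt≡sum inner-ones) (cnt≡sum inner-ones)) (≡-sym (sum-+ _ _)) ⟩
    sum (λ v → [ inner-ones v ] + [ inner-ones v ])   ≤⟨ sum-mono twice ⟩
    sum (λ v → cnt (λ w → pendant v w))               ≡⟨ sum-cnt-swap pendant ⟩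
    sum (λ w → cnt (λ v → pendant v w))               ≤⟨ sum-mono once ⟩
    sum (λ w → [ leaf w ])                            ≡⟨ cnt≡sum leaf ⟨
    cnt leaf                                          ∎
    where
    open ≤-Reasoning
    pendant : Fin n → Fin n → Bool
    pendant v w = not (leaf v) ∧ adj F v w ∧ leaf w
    twice : ∀ v → [ inner-ones v ] + [ inner-ones v ] ≤ cnt (pendant v)
    twice v = go (true? (inner-ones v))
      where
      go : inner-ones v ≡ true ⊎ inner-ones v ≡ false → [ inner-ones v ] + [ inner-ones v ] ≤ cnt (pendant v)
      go (inj₂ q) = subst (λ z → [ z ] + [ z ] ≤ cnt (pendant v)) (≡-sym q) z≤n
      go (inj₁ q) = subst (λ z → [ z ] + [ z ] ≤ cnt (pendant v)) (≡-sym q)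
        (≤-trans two-leaves (cnt-mono λ w p → ∧-intro (∧-elimˡ {not (leaf v)} q) p))
        where
        two-leaves : 2 ≤ cnt (λ w → adj F v w ∧ leaf w)
        two-leaves = +-cancelʳ-≤ 1 2 _ (begin
          3                                           ≤⟨ internal-deg (not-true (∧-elimˡ q)) ⟩
          cnt (adj F v)                               ≡⟨ degree-split v ⟩
          _ + inner v                                 ≡⟨ cong (cnt (λ w → adj F v w ∧ leaf w) +_) (witness (inner v ≟ 1) (∧-elimʳ {not (leaf v)} q)) ⟩
          _ + 1                                       ∎)
    once : ∀ w → cnt (λ v → pendant v w) ≤ [ leaf w ]
    once w = go (true? (leaf w))
      where
      go : leaf w ≡ true ⊎ leaf w ≡ false → cnt (λ v → pendant v w) ≤ [ leaf w ]
      go (inj₂ q) = ≤-trans (≤-reflexive (cnt-zero _ λ v p → false≢true q (∧-elimʳ {adj F v w} (∧-elimʳ {not (leaf v)} p)))) z≤n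
      go (inj₁ q) = subst (λ z → cnt (λ v → pendant v w) ≤ [ z ]) (≡-sym q)
        (cnt-unique _ λ v v′ p p′ → trans (hub-unique′ q (∧-elimˡ (∧-elimʳ {not (leaf v)} p)))
                                      (≡-sym (hub-unique′ q (∧-elimˡ (∧-elimʳ {not (leaf v′)} p′)))))

  -- A high vertex has no big leaf: after the first one there would be at least two more big leaves
  -- or internal neighbours, so it would have class 0 and be small. Thus its three or more big
  -- neighbours are internal.
  high⇒inner≥3 : (∀ u → leaf u ≡ true → class u ≡ 0 → small s t u ≡ true) →
                 ∀ v → high s t v ≡ true → inner≥3 v ≡ true
  high⇒inner≥3 primary-small v hv = ∧-intro (∧-elimˡ hv) (dec-true (3 ≤? inner v) (≤-trans 3≤b (cnt-mono sub)))
    where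
    3≤b : 3 ≤ bigs s t v
    3≤b = witness (3 ≤? bigs s t v) (∧-elimʳ {not (leaf v)} hv)
    big bigLeaf : Fin n → Bool
    big w = adj F v w ∧ not (small s t w)
    bigLeaf w = big w ∧ leaf w
    none : ¬ ∃ λ w → bigLeaf w ≡ true
    none ex = not-elim (∧-elimʳ {adj F v a} (∧-elimˡ qa)) (primary-small a la class-a)
      where
      -- Maximising `n ∸ toℕ w` selects the smallest vertex number.
      first : ∃ λ a → bigLeaf a ≡ true × (∀ w → bigLeaf w ≡ true → n ∸ toℕ w ≤ n ∸ toℕ a)
      first = argmax bigLeaf (λ w → n ∸ toℕ w) ex
      a : Fin n
      a = proj₁ first
      qa : bigLeaf a ≡ true
      qa = proj₁ (proj₂ first)
      la : leaf a ≡ true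
      la = ∧-elimʳ {big a} qa
      v≡hub : v ≡ hub a
      v≡hub = hub-unique′ la (∧-elimˡ (∧-elimˡ qa))
      later : ∀ w → big w ∧ not (does (w Fin.≟ a)) ≡ true →
              adj F (hub a) w ∧ (not (leaf w) ∨ does (toℕ a <? toℕ w)) ≡ true
      later w q = ∧-intro (subst (λ z → adj F z w ≡ true) v≡hub (∧-elimˡ (∧-elimˡ q))) (go (true? (leaf w)))
        where
        go : leaf w ≡ true ⊎ leaf w ≡ false → not (leaf w) ∨ does (toℕ a <? toℕ w) ≡ true
        go (inj₂ iw) = subst (λ z → not z ∨ does (toℕ a <? toℕ w) ≡ true) (≡-sym iw) refl
        go (inj₁ lw) = ∨-introʳ (not (leaf w)) (dec-true (toℕ a <? toℕ w) (≤∧≢⇒<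
          (≮⇒≥ λ w<a → <⇒≱ (∸-monoʳ-< w<a (<⇒≤ (Fin.toℕ<n a))) (proj₂ (proj₂ first) w (∧-intro (∧-elimˡ q) lw)))
          (λ a≡w → ≟-elim (∧-elimʳ {big w} q) (≡-sym (Fin.toℕ-injective a≡w)))))
      2≤after : 2 ≤ after a
      2≤after = ≤-pred (≤-trans 3≤b (≤-trans (cnt-except big a) (s≤s (cnt-mono later))))
      class-a : class a ≡ 0
      class-a = trans (class-internal (subst (λ z → leaf z ≡ false) v≡hub (not-true (∧-elimˡ hv)))) (m≤n⇒m∸n≡0 2≤after)
    sub : ∀ w → big w ≡ true → adj F v w ∧ not (leaf w) ≡ true
    sub w q = ∧-intro (∧-elimˡ q) (not-intro λ lw → none (w , ∧-intro q lw))

  -- The small leaves do not exhaust class 0.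
  module Scarce (small-primary : ∀ u → small s t u ≡ true → class u ≡ 0) where

    sm : Fin n → Bool
    sm = small s t

    primary-hub : ∀ {u} → class u ≡ 0 → leaf (hub u) ≡ false × 2 ≤ after u
    primary-hub {u} c≡0 with true? (leaf (hub u))
    ... | inj₁ p = contradiction (trans (≡-sym (class-leaf p)) c≡0) λ ()
    ... | inj₂ p = p , m∸n≡0⇒m≤n (trans (≡-sym (class-internal p)) c≡0)

    smalls : Fin n → ℕ
    smalls v = cnt (λ w → adj F v w ∧ sm w)

    -- Without small leaves at `v` this is the degree bound. Otherwise the last small leaf has class
    -- 0, and the two or more neighbours counted by its `after` are not small.
    bigs≥2 : ∀ {v} → leaf v ≡ false → 2 ≤ bigs s t v
    bigs≥2 {v} int = ≮⇒≥ λ b<2 → <⇒≱ b<2 (from (cnt-∃ _ (+-cancelʳ-≤ 1 1 (smalls v) (≤-trans (<⇒≤ (subst (3 ≤_)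
                       (cnt-split (adj F v) sm) (internal-deg int))) (+-monoʳ-≤ (smalls v) (≤-pred b<2))))))
      where
      from : (∃ λ w → adj F v w ∧ sm w ≡ true) → 2 ≤ bigs s t v
      from ex = ≤-trans (proj₂ (primary-hub (small-primary a sa))) (cnt-mono sub)
        where
        top : ∃ λ a → adj F v a ∧ sm a ≡ true × (∀ w → adj F v w ∧ sm w ≡ true → toℕ w ≤ toℕ a)
        top = argmax _ toℕ ex
        a : Fin n
        a = proj₁ top
        sa : sm a ≡ true
        sa = ∧-elimʳ {adj F v a} (proj₁ (proj₂ top))
        v≡hub : v ≡ hub a
        v≡hub = hub-unique′ (∧-elimˡ sa) (∧-elimˡ (proj₁ (proj₂ top)))
        sub : ∀ w → adj F (hub a) w ∧ (not (leaf w) ∨ does (toℕ a <? toℕ w)) ≡ true → adj F v w ∧ not (sm w) ≡ true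
        sub w q = ∧-intro vw (not-intro λ sw → go sw (∧-elimʳ {adj F (hub a) w} q))
          where
          vw : adj F v w ≡ true
          vw = subst (λ z → adj F z w ≡ true) (≡-sym v≡hub) (∧-elimˡ q)
          go : sm w ≡ true → ¬ (not (leaf w) ∨ does (toℕ a <? toℕ w) ≡ true)
          go sw r = <⇒≱ (witness (toℕ a <? toℕ w) (subst (λ z → not z ∨ does (toℕ a <? toℕ w) ≡ true) (∧-elimˡ sw) r))
                        (proj₂ (proj₂ top) w (∧-intro vw sw))

    -- The sum of deg - 2 over a forest is at most 0. A leaf contributes -1; an internal vertex
    -- contributes at least the number of its small leaves, and one more if it is high.
    high+small≤leaf : cnt (high s t) + cnt sm ≤ cnt leaf
    high+small≤leaf = +-cancelˡ-≤ (sum (λ _ → 2)) _ _ (begin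
      sum twos + (cnt (high s t) + cnt sm)
        ≤⟨ +-monoʳ-≤ (sum twos) (+-mono-≤ (≤-reflexive (cnt≡sum (high s t))) small≤) ⟩
      sum twos + (sum (λ v → [ high s t v ]) + sum (λ v → cnt (pendant v)))
        ≡⟨ trans (cong (sum twos +_) (≡-sym (sum-+ _ _))) (≡-sym (sum-+ twos _)) ⟩
      sum (λ v → 2 + ([ high s t v ] + cnt (pendant v)))
        ≤⟨ sum-mono pointwise ⟩
      sum (λ v → cnt (adj F v) + [ leaf v ])
        ≡⟨ trans (sum-+ _ _) (cong (sum (λ v → cnt (adj F v)) +_) (≡-sym (cnt≡sum leaf))) ⟩
      sum (λ v → cnt (adj F v)) + cnt leaf
        ≤⟨ +-monoˡ-≤ _ (forest-degSum F acyclic (λ _ → true)) ⟩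
      2 * cnt {n} (λ _ → true) + cnt leaf
        ≡⟨ cong (_+ cnt leaf) (trans (cong (2 *_) (cnt≡sum (λ _ → true))) (≡-sym (sum-*ˡ 2 _))) ⟩
      sum twos + cnt leaf ∎)
      where
      open ≤-Reasoning
      twos : Fin n → ℕ
      twos _ = 2
      pendant : Fin n → Fin n → Bool
      pendant v w = not (leaf v) ∧ adj F v w ∧ sm w
      small≤ : cnt sm ≤ sum (λ v → cnt (pendant v))
      small≤ = begin
        cnt sm                                  ≡⟨ cnt≡sum sm ⟩
        sum (λ w → [ sm w ])                    ≤⟨ sum-mono covered ⟩
        sum (λ w → cnt (λ v → pendant v w))     ≡⟨ sum-cnt-swap pendant ⟨
        sum (λ v → cnt (pendant v))             ∎
        where
        covered : ∀ w → [ sm w ] ≤ cnt (λ v → pendant v w)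
        covered w with true? (sm w)
        ... | inj₂ q = subst (λ z → [ z ] ≤ cnt (λ v → pendant v w)) (≡-sym q) z≤n
        ... | inj₁ q = subst (λ z → [ z ] ≤ cnt (λ v → pendant v w)) (≡-sym q)
          (cnt-pos _ {hub w} (∧-intro (not-false (proj₁ (primary-hub (small-primary w q)))) (∧-intro (adj-sym F (adj-hub w)) q)))
      pointwise : ∀ v → 2 + ([ high s t v ] + cnt (pendant v)) ≤ cnt (adj F v) + [ leaf v ]
      pointwise v with true? (leaf v)
      ... | inj₁ lf = ≤-reflexive (trans
        (cong₂ (λ y z → 2 + ([ y ] + z)) (cong (λ z → not z ∧ does (3 ≤? bigs s t v)) lf)
               (cnt-zero (pendant v) λ w p → not-elim (∧-elimˡ p) lf))
        (≡-sym (cong₂ (λ y z → y + [ z ]) (leaf-deg lf) lf)))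
      ... | inj₂ int = begin
        2 + ([ high s t v ] + cnt (pendant v))
          ≤⟨ +-mono-≤ (≤-refl {2}) (+-mono-≤ (≤-reflexive (cong (λ z → [ not z ∧ does (3 ≤? bigs s t v) ]) int))
                                          (cnt-mono λ w → ∧-elimʳ {not (leaf v)})) ⟩
        2 + ([ does (3 ≤? bigs s t v) ] + smalls v)   ≤⟨ +-monoˡ-≤ (smalls v) (count (bigs s t v) (bigs≥2 int)) ⟩
        bigs s t v + smalls v                         ≡⟨ +-comm (bigs s t v) (smalls v) ⟩
        smalls v + bigs s t v                         ≡⟨ cnt-split (adj F v) sm ⟨
        cnt (adj F v)                                 ≤⟨ m≤m+n _ _ ⟩
        cnt (adj F v) + [ leaf v ]                    ∎
        where
        count : ∀ b → 2 ≤ b → 2 + [ does (3 ≤? b) ] ≤ b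
        count 1 (s≤s ())
        count 2 _ = ≤-refl
        count (suc (suc (suc b))) _ = s≤s (s≤s (s≤s z≤n))

    -- There are at most as many high vertices as big leaves, whose weights are distinct and lie
    -- above `s` and up to `s + s`.
    high≤s : cnt (high s t) ≤ s
    high≤s = ≤-trans (+-cancelʳ-≤ (cnt sm) _ _ (≤-trans high+small≤leaf
                       (≤-reflexive (trans (cnt-split leaf (λ w → does (t w ≤? s))) (+-comm (cnt sm) _)))))
                     (cnt-interval _ t (suc s) s
                       (λ w q → ≰⇒> (λ le → not-elim (∧-elimʳ {leaf w} q) (dec-true (t w ≤? s) le)) , s≤s (t-high (∧-elimˡ q)))
                       (λ u w p q → t-inj (∧-elimˡ p) (∧-elimˡ q)))

  -- If some leaf of class 0 is big, every small leaf has class 0 and `Scarce` applies. If none is,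
  -- high vertices number at most half of the leaves.
  high≤s : cnt (high s t) ≤ s
  high≤s with Fin.any? (λ u → (leaf u ∧ does (class u ≟ 0)) ∧ not (small s t u) Data.Bool.≟ true)
  ... | no ¬ex = ≤-trans (cnt-mono (high⇒inner≥3 primary-small)) (≤-trans inner≥3≤inner-ones
                   (halve (≤-trans inner-ones≤ (<⇒≤ s-low))))
    where
    primary-small : ∀ u → leaf u ≡ true → class u ≡ 0 → small s t u ≡ true
    primary-small u lu c≡0 with true? (small s t u)
    ... | inj₁ p = p
    ... | inj₂ p = contradiction (u , ∧-intro (∧-intro lu (dec-true (class u ≟ 0) c≡0)) (not-false p)) ¬ex
    halve : ∀ {a b} → a + a ≤ b + b → a ≤ b
    halve le = ≮⇒≥ λ b<a → <⇒≱ (+-mono-< b<a b<a) le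
  ... | yes (u₀ , q) = Scarce.high≤s small-primary
    where
    small-primary : ∀ u → small s t u ≡ true → class u ≡ 0
    small-primary u su = n≤0⇒n≡0 (≮⇒≥ λ lt → not-elim (∧-elimʳ {leaf u₀ ∧ does (class u₀ ≟ 0)} q)
      (small-class {u₀} {u} (∧-elimˡ (∧-elimˡ q))
        (subst (_< class u) (≡-sym (witness (class u₀ ≟ 0) (∧-elimʳ {leaf u₀} (∧-elimˡ q)))) lt) su))

  ranking : Ranking s
  ranking = record
    { t = t ; t-low = λ _ → s≤s (s≤s z≤n) ; t-high = t-high ; t-inj = t-inj ; t-K₂ = t-K₂
    ; bigs≥1 = bigs≥1 ; high≤s = high≤s }

-- The lower bound and the theorem

module _ {n} (F : Graph n) (deg≢2 : ∀ v → deg F v ≢ 2) (deg≢0 : ∀ v → deg F v ≢ 0) where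
  open Degrees F deg≢2 deg≢0

  -- A leaf weight is a sum of two labels, so it takes one of the `s + s ∸ 1` values from `2` to
  -- `s + s`.
  leaves≤ : ∀ {s} → 1 ≤ s → HasIrregular F s → cnt leaf ≤ s + s ∸ 1
  leaves≤ {s} 1≤s (w , irr) = cnt-interval leaf (wt w) 2 (s + s ∸ 1) bounds
    (λ u v _ _ eq → decidable-stable (u Fin.≟ v) λ u≢v → irr u v u≢v eq)
    where
    wt≡ : ∀ {v} → leaf v ≡ true → wt w v ≡ wv w v + we w v (hub v)
    wt≡ {v} lf = cong (wv w v +_) (trans (sum-allFin _) (trans (sum-single _ (hub v) other)
                   (cong (λ z → if z then we w v (hub v) else 0) (adj-hub v))))
      where
      other : ∀ u → u ≢ hub v → (if adj F v u then we w v u else 0) ≡ 0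
      other u u≢ with adj F v u in eq
      ... | false = refl
      ... | true  = contradiction (hub-unique lf eq) u≢
    bounds : ∀ v → leaf v ≡ true → 2 ≤ wt w v × wt w v < 2 + (s + s ∸ 1)
    bounds v lf = subst (2 ≤_) (≡-sym (wt≡ lf)) (+-mono-≤ (wv-low w v) (we-low w v (hub v) (adj-hub v)))
                , s≤s (≤-trans (subst (_≤ s + s) (≡-sym (wt≡ lf)) (+-mono-≤ (wv-high w v) (we-high w v (hub v) (adj-hub v))))
                               (≤-reflexive (≡-sym (m+[n∸m]≡n (≤-trans 1≤s (m≤m+n s s))))))

theorem1 : ∀ (n : ℕ) (F : Graph n) → 1 ≤ n → Forest F
    → (∀ (v : Fin n) → deg F v ≢ 2) → (∀ (v : Fin n) → deg F v ≢ 0)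
    → IsTvs F ((n₁ F + 2) / 2)
theorem1 n F 1≤n acyclic deg≢2 deg≢0 = (weighting , irregular) , minimal
  where
  open Degrees F deg≢2 deg≢0
  -- Rounding `(n₁ + 2) / 2` down is rounding `(n₁ + 1) / 2` up.
  s : ℕ
  s = (n₁ F + 2) / 2
  N≡ : n₁ F + 2 ≡ 2 + cnt leaf
  N≡ = trans (cong (_+ 2) n₁≡cnt) (+-comm (cnt leaf) 2)
  double : s * 2 ≡ s + s
  double = trans (*-comm s 2) (cong (s +_) (+-identityʳ s))
  -- The remainder is 0 or 1, which yields both bounds on `s + s`.
  division : 2 + cnt leaf ≡ (n₁ F + 2) % 2 + (s + s)
  division = trans (≡-sym N≡) (trans (m≡m%n+[m/n]*n (n₁ F + 2) 2) (cong ((n₁ F + 2) % 2 +_) double))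
  s-low : cnt leaf < s + s
  s-low = ≤-pred (≤-trans (≤-reflexive division) (+-monoˡ-≤ (s + s) (≤-pred (m%n<n (n₁ F + 2) 2))))
  s-high : s + s ≤ 2 + cnt leaf
  s-high = ≤-trans (m≤n+m (s + s) ((n₁ F + 2) % 2)) (≤-reflexive (≡-sym division))
  instance
    s≢0 : NonZero s
    s≢0 = >-nonZero (n≢0⇒n>0 λ s≡0 → contradiction (subst (λ z → cnt leaf < z + z) s≡0 s-low) λ ())
  open Labelling.Construction F deg≢2 deg≢0 s (Order.ranking F acyclic deg≢2 deg≢0 s s-low s-high)
    using (weighting; irregular)
  minimal : ∀ s′ → HasIrregular F s′ → s ≤ s′
  minimal s′ h@(w , _) = ≤-pred (m<n*o⇒m/o<n {n₁ F + 2} {suc s′} {2} (begin-strict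
    n₁ F + 2                ≡⟨ N≡ ⟩
    2 + cnt leaf            ≤⟨ s≤s (s≤s (leaves≤ F deg≢2 deg≢0 1≤s′ h)) ⟩
    2 + (s′ + s′ ∸ 1)       ≡⟨ cong suc (m+[n∸m]≡n (≤-trans 1≤s′ (m≤m+n s′ s′))) ⟩
    suc (s′ + s′)           <⟨ ≤-refl ⟩
    2 + (s′ + s′)           ≡⟨ cong (2 +_) (trans (cong (s′ +_) (≡-sym (+-identityʳ s′))) (*-comm 2 s′)) ⟩
    suc s′ * 2              ∎))
    where
    open ≤-Reasoning
    -- Any vertex label shows `1 ≤ s′`, so that `s′ + s′ ∸ 1` is not truncated.
    v₀ : Fin n
    v₀ = Fin.fromℕ< 1≤n
    1≤s′ : 1 ≤ s′
    1≤s′ = ≤-trans (wv-low w v₀) (wv-high w v₀)
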